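{- Let $(\mathcal I,\|-\|)$ be a complete interpretation of a circuit signature $\Sigma$ with value set $\mathbf V$, and let $\leq$ be a total order on $\mathbf V$. Then $[\![-]\!]^{\mathsf S}_{\mathcal I}\circ\|-\|^\leq_{\mathcal I}\circ\langle\!\langle-\rangle\!\rangle_{\mathcal I}=\mathrm{id}_{\mathbf{Stream}_{\mathcal I}}$; that is, for every stream function $f$ in $\mathbf{Stream}_{\mathcal I}$, the circuit $\|\langle\!\langle f\rangle\!\rangle_{\mathcal I}\|^\leq_{\mathcal I}$ satisfies $[\![\,\|\langle\!\langle f\rangle\!\rangle_{\mathcal I}\|^\leq_{\mathcal I}\,]\!]^{\mathsf S}_{\mathcal I}=f$.
   Context: Circuits. A circuit signature $\Sigma$ consists of a finite set $\mathbf V$ of values with a distinguished value $\bullet$, a set $\mathcal P$ of primitive symbols, and functions $\mathrm{dom},\mathrm{cod}\colon\mathcal P\to\mathbb N$. A PROP is a strict symmetric monoidal category with objects $\mathbb N$ and addition as tensor on objects. $\mathbf{CCirc}_\Sigma$ is the PROP freely generated by: $p\colon\mathrm{dom}(p)\to\mathrm{cod}(p)$ for $p\in\mathcal P$, a fork $1\to2$, a join $2\to1$, an introduction $\bullet\colon0\to1$, and an elimination $1\to0$; its morphisms are combinational circuits. $\mathbf{SCirc}_\Sigma$ is the symmetric traced PROP freely generated by these together with a value $v\colon0\to1$ for each $v\in\mathbf V\setminus\{\bullet\}$ and a delay $\delta\colon1\to1$ (the "value" $\bullet$ means the introduction generator); its morphisms are sequential circuits. Composition $f;g$ is in diagrammatic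 order; $\mathrm{Tr}^x$ sends $x+m\to x+n$ to $m\to n$. Forks, joins, delays $\delta_n$ and values $\overline v\colon0\to n$ ($\overline v\in\mathbf V^n$) on $n$ wires are defined wirewise. For $\overline v\in\mathbf V^n$ put $\mathrm{reg}(\overline v)\coloneqq(\overline v\otimes\delta_n);\mathrm{join}_n\colon n\to n$ and $\mathrm{const}(\overline v)\coloneqq\mathrm{Tr}^n(\mathrm{reg}(\overline v);\mathrm{fork}_n)\colon0\to n$. Interpretation. An interpretation $\mathcal I$ of $\Sigma$ is a lattice order $\sqsubseteq$ on $\mathbf V$ with $\bullet$ least (also written $\bot$; $\top$ is the greatest element) and, for each $p\in\mathcal P$, a $\bot$-preserving monotone function $[\![p]\!]\colon\mathbf V^{\mathrm{dom}(p)}\to\mathbf V^{\mathrm{cod}(p)}$. $\mathbf{Func}_{\mathcal I}$ is the PROP of $\bot$-preserving monotone functions $\mathbf V^m\to\mathbf V^n$. Streams and denotation. A stream function $f\colon A^\omega\to B^\omega$ is causal if output element $i$ depends only on input elements $0,\dots,i$; then for $a\in A$, its initial output is $f[a]=\mathrm{hd}(f(a::\sigma))$ (independent of $\sigma$) and its stream derivative is $f_a=\sigma\mapsto\mathrm{tl}(f(a::\sigma))$; $f$ is finitely specified if it has finitely many iterated derivatives $f_{\overline a}$, $\overline a\in A^\star$. $\mathbf{Stream}_{\mathcal I}$ has as morphisms $m\to n$ the causal, finitely specified, $\bot$-preserving (least stream to least stream), monotone stream functions $(\mathbf V^m)^\omega\to(\mathbf V^n)^\omega$. $[\![-]\!]^{\mathsf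 S}_{\mathcal I}$ is the traced PROP morphism sending circuits $m\to n$ to stream functions $(\mathbf V^m)^\omega\to(\mathbf V^n)^\omega$ determined by: primitives act elementwise by $[\![p]\!]$; fork copies; join is the elementwise $\sqcup$; introduction is the constant stream $\bot$; elimination discards; $v\mapsto v::\bot::\bot::\cdots$; $\delta\mapsto(\sigma\mapsto\bot::\sigma)$; the trace of $f\colon(\mathbf V^{x+m})^\omega\to(\mathbf V^{x+n})^\omega$ is $\sigma\mapsto\pi_1(f(\mu_f(\sigma),\sigma))$, with $\mu_f(\sigma)$ the least fixed point of $\tau\mapsto\pi_0(f(\tau,\sigma))$. Completeness. A complete interpretation is an interpretation with a map $\|-\|$ sending each $f\colon\mathbf V^m\to\mathbf V^n$ in $\mathbf{Func}_{\mathcal I}$ to a circuit of the form $(\mathrm{const}(\overline v)\otimes\mathrm{id}_m);g$ with $g$ combinational, such that $[\![\|f\|]\!]^{\mathsf S}_{\mathcal I}(\sigma)(i)=f(\sigma(i))$ for all $\sigma$ and $i$. From streams to Mealy machines. For $f\in\mathbf{Stream}_{\mathcal I}$, $\langle\!\langle f\rangle\!\rangle_{\mathcal I}$ is the initialised Mealy machine $(S,g,f)$ where $S$ is the least set of stream functions containing $f$ and closed under stream derivatives, ordered pointwise ($h\preceq h'$ iff $h(\sigma)\leq h'(\sigma)$ for all $\sigma$), $g(h,a)=\langle h_a,h[a]\rangle$ (next state, output), and the initial state is $f$. The function $g$ is monotone. From Mealy machines to circuits. Let $(S,f,s_0)$ be a machine with finite poset of states $(S,\preceq)$, initial state $s_0$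 and monotone $f\colon S\times\mathbf V^m\to S\times\mathbf V^n$ with transition and output components $f_0,f_1$. The total order $\leq$ on $\mathbf V$ is extended to words in $(\mathbf V^m)^\star$ lexicographically (shorter words first). Replace $S$ by its subset of states accessible from $s_0$, totally ordered by comparing, for each state, the minimal word leading to it from $s_0$; list them as $q_0,\dots,q_{k-1}$. The encoding $\gamma\colon S\to\mathbf V^k$ is $\gamma(s)(i)=\top$ if $q_i\preceq s$ and $\bot$ otherwise. The monotone Mealy encoding $\gamma(f)\colon\mathbf V^k\times\mathbf V^m\to\mathbf V^k\times\mathbf V^n$ is the monotone completion of the map $(\gamma(s),\overline x)\mapsto(\gamma(f_0(s,\overline x)),f_1(s,\overline x))$ defined on $\gamma[S]\times\mathbf V^m$; here for $A\subseteq B$ and finite lattices $B,C$, the monotone completion of a monotone $h\colon A\to C$ is $h_{\mathsf m}\colon B\to C$ with $h_{\mathsf m}(v)=h(v)$ if $v\in A$, $h_{\mathsf m}(\bot_B)=\bot_C$ if $\bot_B\notin A$, and otherwise $h_{\mathsf m}(v)=\bigvee\{h_{\mathsf m}(w)\mid w\leq v,w\neq v\}$. The map $\gamma(f)$ lies in $\mathbf{Func}_{\mathcal I}$, and $\|(S,f,s_0)\|^\leq_{\mathcal I}\coloneqq\mathrm{Tr}^k\big((\mathrm{reg}(\gamma(s_0))\otimes\mathrm{id}_m);\|\gamma(f)\|\big)\colon m\to n$. -}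

module Defs where

open import Level using (0ℓ)
open import Data.Bool.Base using (Bool; true; false; T; if_then_else_)
open import Data.Unit.Base using (tt)
open import Data.Nat.Base as ℕ using (ℕ; zero; suc; _+_; _∸_; z≤n; s≤s)
import Data.Nat.Induction as ℕ
import Data.Nat.Properties as ℕ
open import Data.Fin.Base using (Fin; zero; suc; toℕ)
import Data.Fin.Properties as Fin
import Data.Fin.Induction as Fin
open import Data.Fin.Subset using (Subset)
import Data.Fin.Subset as Subset
import Data.Fin.Subset.Properties as Subset
open import Data.Product.Relation.Binary.Pointwise.NonDependent using (_×ₛ_)
import Data.Product.Relation.Binary.Lex.Strict as ×Lex
open import Data.Product.Base using (Σ-syntax; ∃; ∃-syntax; _×_; _,_; proj₁; proj₂)
open import Data.Sum.Base using (inj₁; inj₂)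
open import Data.List.Base as List using (List; []; _∷_)
import Data.List.Membership.Propositional as List
import Data.List.Membership.Propositional.Properties as List
import Data.List.Properties as List
import Data.List.Sort as ListSort
import Data.List.Extrema as ListExtrema
import Data.List.Relation.Binary.Lex.Strict as ListLex
import Data.List.Relation.Binary.Pointwise as ListPointwise
open import Data.List.Relation.Binary.Permutation.Propositional using (↭-sym; ↭⇒↭ₛ)
import Data.List.Relation.Binary.Permutation.Propositional.Properties as Perm
import Data.List.Relation.Binary.Permutation.Setoid.Properties as PermSetoid
open import Data.List.Relation.Unary.All as All using (All; []; _∷_)
import Data.List.Relation.Unary.All.Properties as All
open import Data.List.Relation.Unary.AllPairs as AllPairs using (AllPairs)
import Data.List.Relation.Unary.Linked.Properties as Linked
import Data.List.Relation.Unary.Unique.DecPropositional.Properties as Unique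
open import Data.List.Relation.Unary.Enumerates.Setoid using (IsEnumeration)
import Data.List.Relation.Unary.Enumerates.Setoid.Properties as Enumerates
open import Data.List.Relation.Unary.Any as Any using (Any; here; there)
import Data.List.Relation.Unary.Any.Properties as Any
open import Data.Vec.Base as Vec using (Vec; []; _∷_; _++_; take; drop)
import Data.Vec.Properties as Vec
import Data.Vec.Relation.Binary.Lex.Strict as VecLex
open import Data.Vec.Relation.Binary.Pointwise.Inductive as Pointwise
  using (Pointwise; []; _∷_)
open import Function.Base using (_∘_; _on_; id; flip)
open import Function.Bundles using (_↔_; Inverse)
open import Function.Properties.Inverse using (↔⇒↣)
open import Induction.WellFounded as WF using (WellFounded; Acc; acc)
open import Relation.Binary.Core using (Rel)
open import Relation.Binary.Definitions using (Decidable; DecidableEquality; Tri; tri<; tri≈; tri>)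
open import Relation.Binary.Bundles using (Setoid; StrictTotalOrder)
open import Relation.Binary.Structures
  using (IsPartialOrder; IsStrictPartialOrder; IsTotalOrder; IsStrictTotalOrder; IsDecPartialOrder)
import Relation.Binary.Properties.StrictTotalOrder as STO
open import Relation.Binary.Lattice.Structures using (IsBoundedLattice)
import Relation.Binary.Construct.NonStrictToStrict as ToStrict
import Relation.Binary.Construct.On as On
open import Relation.Binary.PropositionalEquality
  using (_≡_; _≢_; refl; sym; trans; cong; cong₂; subst; subst₂; isEquivalence; setoid; module ≡-Reasoning)
open import Relation.Nullary.Decidable
  using (Dec; yes; no; map′; does; _×-dec_; _→-dec_; ¬¬-excluded-middle; dec-true)
open import Relation.Nullary.Negation using (¬_; contradiction)
import Relation.Unary as Unary

Stream : Set → Set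
Stream A = ℕ → A

infixr 5 _◂_
_◂_ : {A : Set} → A → Stream A → Stream A
(a ◂ σ) zero    = a
(a ◂ σ) (suc i) = σ i

hd : {A : Set} → Stream A → A
hd σ = σ 0

tl : {A : Set} → Stream A → Stream A
tl σ i = σ (suc i)

infixr 5 _++ˢ_
_++ˢ_ : {A : Set} {m n : ℕ} → Stream (Vec A m) → Stream (Vec A n) → Stream (Vec A (m + n))
(σ ++ˢ τ) i = σ i ++ τ i

infix 4 _≐[_]_
_≐[_]_ : {A : Set} → Stream A → ℕ → Stream A → Set
σ ≐[ i ] τ = ∀ {j} → j ℕ.≤ i → σ j ≡ τ j

Causal : {A B : Set} → (Stream A → Stream B) → Set
Causal f = ∀ {σ τ} i → σ ≐[ i ] τ → f σ i ≡ f τ i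

record Signature : Set₁ where
  field
    V      : Set
    ∣V∣    : ℕ
    finite : V ↔ Fin ∣V∣
    •      : V
    P      : Set
    dom    : P → ℕ
    cod    : P → ℕ

  _≟ⱽ_ : DecidableEquality V
  _≟ⱽ_ = Fin.inj⇒≟ (↔⇒↣ finite)

  _≟ⁿ_ : ∀ {n} → DecidableEquality (Vec V n)
  _≟ⁿ_ = Vec.≡-dec _≟ⱽ_

  allValues : List V
  allValues = List.map (Inverse.from finite) (List.allFin ∣V∣)

  ∈-allValues : ∀ v → v List.∈ allValues
  ∈-allValues v = subst (List._∈ allValues) (Inverse.strictlyInverseʳ finite v)
    (List.∈-map⁺ _ (List.∈-allFin (Inverse.to finite v)))

  allVecs : ∀ n → List (Vec V n)
  allVecs zero    = [] ∷ []
  allVecs (suc n) = List.cartesianProductWith _∷_ allValues (allVecs n)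

  ∈-allVecs : ∀ {n} (v : Vec V n) → v List.∈ allVecs n
  ∈-allVecs []       = here refl
  ∈-allVecs (x ∷ xs) = List.∈-cartesianProductWith⁺ _∷_ (∈-allValues x) (∈-allVecs xs)

record Interpretation (𝔖 : Signature) : Set₁ where
  open Signature 𝔖
  infix  4 _⊑_
  infixr 6 _⊔_
  field
    _⊑_              : Rel V 0ℓ
    _⊔_ _⊓_          : V → V → V
    ⊤                : V
    isBoundedLattice : IsBoundedLattice _≡_ _⊑_ _⊔_ _⊓_ ⊤ •

  open IsBoundedLattice isBoundedLattice public
    using (x≤x∨y; y≤x∨y; ∨-least; minimum; maximum; isPartialOrder)
  open IsPartialOrder isPartialOrder public
    using () renaming (refl to ⊑-refl; trans to ⊑-trans; antisym to ⊑-antisym)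

  infix  4 _⊑ⁿ_
  _⊑ⁿ_ : ∀ {n} → Rel (Vec V n) 0ℓ
  _⊑ⁿ_ = Pointwise _⊑_

  ⊥ⁿ : ∀ n → Vec V n
  ⊥ⁿ n = Vec.replicate n •

  infixr 6 _⊔ⁿ_
  _⊔ⁿ_ : ∀ {n} → Vec V n → Vec V n → Vec V n
  _⊔ⁿ_ = Vec.zipWith _⊔_

  Monotone : ∀ {m n} → (Vec V m → Vec V n) → Set
  Monotone f = ∀ {u v} → u ⊑ⁿ v → f u ⊑ⁿ f v

  field
    ⟦_⟧ᴾ        : ∀ p → Vec V (dom p) → Vec V (cod p)
    ⟦⟧ᴾ-monotone : ∀ p → Monotone ⟦ p ⟧ᴾ
    ⟦⟧ᴾ-bot      : ∀ p → ⟦ p ⟧ᴾ (⊥ⁿ _) ≡ ⊥ⁿ _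

  _⊑?_ : Decidable _⊑_
  x ⊑? y = map′ (λ eq → subst (x ⊑_) eq (x≤x∨y x y))
                (λ le → ⊑-antisym (∨-least le ⊑-refl) (y≤x∨y x y))
                ((x ⊔ y) ≟ⱽ y)

  ⊑ⁿ-refl : ∀ {n} {v : Vec V n} → v ⊑ⁿ v
  ⊑ⁿ-refl = Pointwise.refl ⊑-refl

  ⊑ⁿ-reflexive : ∀ {n} {u v : Vec V n} → u ≡ v → u ⊑ⁿ v
  ⊑ⁿ-reflexive refl = ⊑ⁿ-refl

  ⊑ⁿ-trans : ∀ {n} {u v w : Vec V n} → u ⊑ⁿ v → v ⊑ⁿ w → u ⊑ⁿ w
  ⊑ⁿ-trans = Pointwise.trans ⊑-trans

  ⊑ⁿ-antisym : ∀ {n} {u v : Vec V n} → u ⊑ⁿ v → v ⊑ⁿ u → u ≡ v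
  ⊑ⁿ-antisym []       []       = refl
  ⊑ⁿ-antisym (p ∷ ps) (q ∷ qs) = cong₂ _∷_ (⊑-antisym p q) (⊑ⁿ-antisym ps qs)

  _⊑ⁿ?_ : ∀ {n} → Decidable (_⊑ⁿ_ {n})
  _⊑ⁿ?_ = Pointwise.decidable _⊑?_

  ⊑ⁿ-isPartialOrder : ∀ {n} → IsPartialOrder _≡_ (_⊑ⁿ_ {n})
  ⊑ⁿ-isPartialOrder = record
    { isPreorder = record
      { isEquivalence = isEquivalence ; reflexive = ⊑ⁿ-reflexive ; trans = ⊑ⁿ-trans }
    ; antisym = ⊑ⁿ-antisym }

  ⊥ⁿ-least : ∀ {n} (v : Vec V n) → ⊥ⁿ n ⊑ⁿ v
  ⊥ⁿ-least []      = []
  ⊥ⁿ-least (x ∷ v) = minimum x ∷ ⊥ⁿ-least v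

  ⊔ⁿ-upperˡ : ∀ {n} (u v : Vec V n) → u ⊑ⁿ u ⊔ⁿ v
  ⊔ⁿ-upperˡ []      []      = []
  ⊔ⁿ-upperˡ (x ∷ u) (y ∷ v) = x≤x∨y x y ∷ ⊔ⁿ-upperˡ u v

  ⊔ⁿ-upperʳ : ∀ {n} (u v : Vec V n) → v ⊑ⁿ u ⊔ⁿ v
  ⊔ⁿ-upperʳ []      []      = []
  ⊔ⁿ-upperʳ (x ∷ u) (y ∷ v) = y≤x∨y x y ∷ ⊔ⁿ-upperʳ u v

  ⊔ⁿ-least : ∀ {n} {u v w : Vec V n} → u ⊑ⁿ w → v ⊑ⁿ w → u ⊔ⁿ v ⊑ⁿ w
  ⊔ⁿ-least []       []       = []
  ⊔ⁿ-least (p ∷ ps) (q ∷ qs) = ∨-least p q ∷ ⊔ⁿ-least ps qs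

  take⁺ : ∀ m {n} {u v : Vec V (m + n)} → u ⊑ⁿ v → take m u ⊑ⁿ take m v
  take⁺ zero    _        = []
  take⁺ (suc m) (p ∷ ps) = p ∷ take⁺ m ps

  drop⁺ : ∀ m {n} {u v : Vec V (m + n)} → u ⊑ⁿ v → drop m u ⊑ⁿ drop m v
  drop⁺ zero    ps       = ps
  drop⁺ (suc m) (p ∷ ps) = drop⁺ m ps

  infix 4 _⊏ⁿ_
  _⊏ⁿ_ : ∀ {n} → Rel (Vec V n) 0ℓ
  u ⊏ⁿ v = u ⊑ⁿ v × u ≢ v

  _⊏ⁿ?_ : ∀ {n} → Decidable (_⊏ⁿ_ {n})
  _⊏ⁿ?_ = ToStrict.<-decidable _≡_ _⊑ⁿ_ _≟ⁿ_ _⊑ⁿ?_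

  private
    -- A strict order on the finite set V^n is well-founded: transport it to Fin.
    finite-wf : ∀ {n} (_<_ : Rel (Vec V n) 0ℓ) → IsStrictPartialOrder _≡_ _<_ → WellFounded _<_
    finite-wf {n} _<_ spo = WF.Subrelation.wellFounded reindex
        (On.wellFounded index (Fin.spo-wellFounded
          (record { isEquivalence = isEquivalence
                  ; irrefl = λ { {i} refl → irrefl {at i} refl }
                  ; trans = <-trans
                  ; <-resp-≈ = (λ { refl p → p }) , (λ { refl p → p }) })))
      where
      open IsStrictPartialOrder spo using (irrefl) renaming (trans to <-trans)
      index : Vec V n → Fin (List.length (allVecs n))
      index v = Any.index (∈-allVecs v)
      at = List.lookup (allVecs n)
      reindex : ∀ {u v} → u < v → at (index u) < at (index v)
      reindex {u} {v} = subst₂ _<_ (Any.lookup-index (∈-allVecs u)) (Any.lookup-index (∈-allVecs v))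

    ⊏ⁿ-spo : ∀ {n} → IsStrictPartialOrder _≡_ (_⊏ⁿ_ {n})
    ⊏ⁿ-spo = ToStrict.<-isStrictPartialOrder _≡_ _⊑ⁿ_ ⊑ⁿ-isPartialOrder

  abstract
    ⊏ⁿ-wellFounded : ∀ {n} → WellFounded (_⊏ⁿ_ {n})
    ⊏ⁿ-wellFounded = finite-wf _⊏ⁿ_ ⊏ⁿ-spo

    ⊏ⁿ-noetherian : ∀ {n} → WellFounded (flip (_⊏ⁿ_ {n}))
    ⊏ⁿ-noetherian = finite-wf (flip _⊏ⁿ_) (record
      { isEquivalence = isEquivalence
      ; irrefl = λ { refl p → irrefl refl p }
      ; trans = λ p q → <-trans q p
      ; <-resp-≈ = (λ { refl p → p }) , (λ { refl p → p }) })
      where open IsStrictPartialOrder ⊏ⁿ-spo using (irrefl) renaming (trans to <-trans)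

module StreamFunctions {𝔖 : Signature} (ℐ : Interpretation 𝔖) where
  open Signature 𝔖
  open Interpretation ℐ

  Streamⁿ : ℕ → Set
  Streamⁿ n = Stream (Vec V n)

  infix 4 _≤ˢ_
  _≤ˢ_ : ∀ {n} → Rel (Streamⁿ n) 0ℓ
  σ ≤ˢ τ = ∀ i → σ i ⊑ⁿ τ i

  ⊥ˢ : ∀ n → Streamⁿ n
  ⊥ˢ n i = ⊥ⁿ n

  -- Circuits need not denote ⊥-preserving functions (a value does not), so the
  -- target of the denotation keeps only the properties that make feedback
  -- well-defined; StreamMor adds the remaining ones.
  record StreamFn (m n : ℕ) : Set where
    constructor mk
    field
      fn       : Streamⁿ m → Streamⁿ n
      causal   : Causal fn
      monotone : ∀ {σ τ} → σ ≤ˢ τ → fn σ ≤ˢ fn τ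

    fn-cong : ∀ {σ τ} → (∀ i → σ i ≡ τ i) → ∀ i → fn σ i ≡ fn τ i
    fn-cong eq i = causal i (λ {j} _ → eq j)

  open StreamFn public

  infix 4 _≈ˢ_
  _≈ˢ_ : ∀ {m n} → Rel (Streamⁿ m → Streamⁿ n) 0ℓ
  f ≈ˢ g = ∀ σ i → f σ i ≡ g σ i

  record IsLeastFixedPoint {n} (F : Streamⁿ n → Streamⁿ n) (μ : Streamⁿ n) : Set where
    field
      fixed : ∀ i → F μ i ≡ μ i
      least : ∀ τ → (∀ i → F τ i ≡ τ i) → μ ≤ˢ τ

  -- Kleene iteration: by causality, the iterates stabilise on every finite
  -- prefix because V^n is finite.
  module Fixpoint {n} (F : StreamFn n n) where

    iter : ℕ → Streamⁿ n
    iter zero    = ⊥ˢ n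
    iter (suc k) = fn F (iter k)

    iter-ascending : ∀ k → iter k ≤ˢ iter (suc k)
    iter-ascending zero    i = ⊥ⁿ-least _
    iter-ascending (suc k)   = monotone F (iter-ascending k)

    record Stable (i k : ℕ) : Set where
      constructor stable
      field prefix : iter k ≐[ i ] iter (suc k)
    open Stable

    stable-suc : ∀ {i k} → Stable i k → Stable i (suc k)
    stable-suc st = stable λ {j} j≤i → causal F j (λ l≤j → prefix st (ℕ.≤-trans l≤j j≤i))

    stable-+ : ∀ {i k} → Stable i k → ∀ d → Stable i (d + k)
    stable-+ st zero    = st
    stable-+ st (suc d) = stable-suc (stable-+ st d)

    iter-stable : ∀ {i k} → Stable i k → ∀ d → iter k ≐[ i ] iter (d + k)
    iter-stable st zero    j≤i = refl
    iter-stable st (suc d) j≤i = trans (iter-stable st d j≤i) (prefix (stable-+ st d) j≤i)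

    private
      extend : ∀ {i k} → Stable i k → iter k (suc i) ≡ iter (suc k) (suc i) → Stable (suc i) k
      extend {i} {k} st eq = stable go where
        go : iter k ≐[ suc i ] iter (suc k)
        go j≤si with ℕ.m≤n⇒m<n∨m≡n j≤si
        ... | inj₁ (s≤s j≤i) = prefix st j≤i
        ... | inj₂ refl      = eq

      search₀ : ∀ k → Acc (flip _⊏ⁿ_) (iter k 0) → ∃ (Stable 0)
      search₀ k (acc rs) with iter k 0 ≟ⁿ iter (suc k) 0
      ... | yes eq = k , stable λ { z≤n → eq }
      ... | no neq = search₀ (suc k) (rs (iter-ascending k 0 , neq))

      search : ∀ i k → Stable i k → Acc (flip _⊏ⁿ_) (iter k (suc i)) → ∃ (Stable (suc i))
      search i k st (acc rs) with iter k (suc i) ≟ⁿ iter (suc k) (suc i)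
      ... | yes eq = k , extend st eq
      ... | no neq = search i (suc k) (stable-suc st) (rs (iter-ascending k (suc i) , neq))

    stabilises : ∀ i → ∃ (Stable i)
    stabilises zero    = search₀ 0 (⊏ⁿ-noetherian _)
    stabilises (suc i) with stabilises i
    ... | k , st = search i k st (⊏ⁿ-noetherian _)

    μ : Streamⁿ n
    μ i = iter (proj₁ (stabilises i)) i

    μ-stable : ∀ {i k} → Stable i k → μ ≐[ i ] iter k
    μ-stable {i} {k} st {j} j≤i = begin
      iter kⱼ j       ≡⟨ iter-stable stⱼ k ℕ.≤-refl ⟩
      iter (k + kⱼ) j ≡⟨ cong (λ l → iter l j) (ℕ.+-comm k kⱼ) ⟩
      iter (kⱼ + k) j ≡⟨ sym (iter-stable st kⱼ j≤i) ⟩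
      iter k j        ∎
      where
      open ≡-Reasoning
      kⱼ  = proj₁ (stabilises j)
      stⱼ = proj₂ (stabilises j)

    μ-fixed : ∀ i → fn F μ i ≡ μ i
    μ-fixed i with stabilises i in eq
    ... | k , st = begin
      fn F μ i        ≡⟨ causal F i (μ-stable st) ⟩
      fn F (iter k) i ≡⟨ sym (prefix st ℕ.≤-refl) ⟩
      iter k i        ∎
      where open ≡-Reasoning

    μ-least-prefixed : ∀ τ → fn F τ ≤ˢ τ → μ ≤ˢ τ
    μ-least-prefixed τ Fτ≤τ i = iter-below (proj₁ (stabilises i)) i
      where
      iter-below : ∀ k → iter k ≤ˢ τ
      iter-below zero    i = ⊥ⁿ-least _
      iter-below (suc k) i = ⊑ⁿ-trans (monotone F (iter-below k) i) (Fτ≤τ i)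

    μ-isLeastFixedPoint : IsLeastFixedPoint (fn F) μ
    μ-isLeastFixedPoint = record
      { fixed = μ-fixed
      ; least = λ τ eq → μ-least-prefixed τ (λ i → ⊑ⁿ-reflexive (eq i)) }

  μ-causal : ∀ {n} (F G : StreamFn n n) i →
             (∀ τ → fn F τ ≐[ i ] fn G τ) → Fixpoint.μ F i ≡ Fixpoint.μ G i
  μ-causal F G i F≐G = begin
    FF.μ i              ≡⟨ FF.iter-stable (proj₂ (FF.stabilises i)) l ℕ.≤-refl ⟩
    FF.iter (l + k) i   ≡⟨ agree (l + k) ℕ.≤-refl ⟩
    GG.iter (l + k) i   ≡⟨ cong (λ d → GG.iter d i) (ℕ.+-comm l k) ⟩
    GG.iter (k + l) i   ≡⟨ sym (GG.iter-stable (proj₂ (GG.stabilises i)) k ℕ.≤-refl) ⟩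
    GG.μ i              ∎
    where
    open ≡-Reasoning
    module FF = Fixpoint F
    module GG = Fixpoint G
    k = proj₁ (FF.stabilises i)
    l = proj₁ (GG.stabilises i)
    agree : ∀ d → FF.iter d ≐[ i ] GG.iter d
    agree zero    j≤i     = refl
    agree (suc d) {j} j≤i = trans (F≐G (FF.iter d) j≤i)
      (causal G j (λ l≤j → agree d (ℕ.≤-trans l≤j j≤i)))

  lift : ∀ {m n} (f : Vec V m → Vec V n) → Monotone f → StreamFn m n
  lift f mono = mk (λ σ i → f (σ i)) (λ i eq → cong f (eq ℕ.≤-refl)) (λ le i → mono (le i))

  idˢ : ∀ n → StreamFn n n
  idˢ n = lift id id

  infixl 6 _⨾ˢ_
  _⨾ˢ_ : ∀ {l m n} → StreamFn l m → StreamFn m n → StreamFn l n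
  f ⨾ˢ g = mk (fn g ∘ fn f)
    (λ i eq → causal g i (λ {j} j≤i → causal f j (λ l≤j → eq (ℕ.≤-trans l≤j j≤i))))
    (monotone g ∘ monotone f)

  infixr 7 _⊗ˢ_
  _⊗ˢ_ : ∀ {m n p q} → StreamFn m n → StreamFn p q → StreamFn (m + p) (n + q)
  _⊗ˢ_ {m} f g = mk (λ σ → fn f (take m ∘ σ) ++ˢ fn g (drop m ∘ σ))
    (λ i eq → cong₂ _++_ (causal f i (λ j≤i → cong (take m) (eq j≤i)))
                         (causal g i (λ j≤i → cong (drop m) (eq j≤i))))
    (λ le i → Pointwise.++⁺ (monotone f (λ j → take⁺ m (le j)) i)
                            (monotone g (λ j → drop⁺ m (le j)) i))

  swapˢ : ∀ m n → StreamFn (m + n) (n + m)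
  swapˢ m n = lift (λ v → drop m v ++ take m v) (λ le → Pointwise.++⁺ (drop⁺ m le) (take⁺ m le))

  module _ {x m n} (f : StreamFn (x + m) (x + n)) where

    loop : Streamⁿ m → StreamFn x x
    loop σ = mk (λ τ → take x ∘ fn f (τ ++ˢ σ))
      (λ i eq → cong (take x) (causal f i (λ {j} j≤i → cong (_++ σ j) (eq j≤i))))
      (λ le i → take⁺ x (monotone f (λ j → Pointwise.++⁺ (le j) ⊑ⁿ-refl) i))

    -- The least fixed point, by feedback-isLeastFixedPoint.
    feedback : Streamⁿ m → Streamⁿ x
    feedback σ = Fixpoint.μ (loop σ)

    feedback-isLeastFixedPoint : ∀ σ →
      IsLeastFixedPoint (λ τ → take x ∘ fn f (τ ++ˢ σ)) (feedback σ)
    feedback-isLeastFixedPoint σ = Fixpoint.μ-isLeastFixedPoint (loop σ)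

    feedback-causal : Causal feedback
    feedback-causal {σ} {σ′} i eq = μ-causal (loop σ) (loop σ′) i λ τ {j} j≤i →
      cong (take x) (causal f j (λ {l} l≤j → cong (τ l ++_) (eq (ℕ.≤-trans l≤j j≤i))))

    feedback-monotone : ∀ {σ σ′} → σ ≤ˢ σ′ → feedback σ ≤ˢ feedback σ′
    feedback-monotone {σ} {σ′} le = Fixpoint.μ-least-prefixed (loop σ) (feedback σ′) λ i →
      ⊑ⁿ-trans (take⁺ x (monotone f (λ j → Pointwise.++⁺ ⊑ⁿ-refl (le j)) i))
               (⊑ⁿ-reflexive (Fixpoint.μ-fixed (loop σ′) i))

    Trˢ : StreamFn m n
    Trˢ = mk (λ σ → drop x ∘ fn f (feedback σ ++ˢ σ))
      (λ i eq → cong (drop x) (causal f i (λ {j} j≤i →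
        cong₂ _++_ (feedback-causal j (λ l≤j → eq (ℕ.≤-trans l≤j j≤i))) (eq j≤i))))
      (λ le i → drop⁺ x (monotone f (λ j → Pointwise.++⁺ (feedback-monotone le j) (le j)) i))

infixl 6 _⨾_
infixr 7 _⊗_

-- Morphisms of the free (traced, when the flag is set) PROP on G are the terms
-- below up to the congruence _≈_.
data Tm (traced : Bool) (G : ℕ → ℕ → Set) : ℕ → ℕ → Set where
  gen  : ∀ {m n} → G m n → Tm traced G m n
  idᵗ  : ∀ n → Tm traced G n n
  _⨾_  : ∀ {l m n} → Tm traced G l m → Tm traced G m n → Tm traced G l n
  _⊗_  : ∀ {m n p q} → Tm traced G m n → Tm traced G p q → Tm traced G (m + p) (n + q)
  swap : ∀ m n → Tm traced G (m + n) (n + m)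
  Tr   : {tr : T traced} → ∀ x {m n} → Tm traced G (x + m) (x + n) → Tm traced G m n

-- The monoidal structure of a PROP is strict, so a cast is an identity.
cast : ∀ {t G m m′ n n′} → m ≡ m′ → n ≡ n′ → Tm t G m n → Tm t G m′ n′
cast {t} {G} = subst₂ (Tm t G)

infix 4 _≈_

data _≈_ {t : Bool} {G : ℕ → ℕ → Set} : ∀ {m n} → Rel (Tm t G m n) 0ℓ where
  ≈-refl  : ∀ {m n} {f : Tm t G m n} → f ≈ f
  ≈-sym   : ∀ {m n} {f g : Tm t G m n} → f ≈ g → g ≈ f
  ≈-trans : ∀ {m n} {f g h : Tm t G m n} → f ≈ g → g ≈ h → f ≈ h
  ⨾-cong  : ∀ {l m n} {f f′ : Tm t G l m} {g g′ : Tm t G m n} → f ≈ f′ → g ≈ g′ → f ⨾ g ≈ f′ ⨾ g′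
  ⊗-cong  : ∀ {m n p q} {f f′ : Tm t G m n} {g g′ : Tm t G p q} → f ≈ f′ → g ≈ g′ → f ⊗ g ≈ f′ ⊗ g′
  Tr-cong : ∀ {tr : T t} {x m n} {f f′ : Tm t G (x + m) (x + n)} → f ≈ f′ → Tr {tr = tr} x f ≈ Tr {tr = tr} x f′

  ⨾-identityˡ : ∀ {m n} (f : Tm t G m n) → idᵗ m ⨾ f ≈ f
  ⨾-identityʳ : ∀ {m n} (f : Tm t G m n) → f ⨾ idᵗ n ≈ f
  ⨾-assoc     : ∀ {k l m n} (f : Tm t G k l) (g : Tm t G l m) (h : Tm t G m n) →
                (f ⨾ g) ⨾ h ≈ f ⨾ (g ⨾ h)

  ⊗-id        : ∀ m n → idᵗ m ⊗ idᵗ n ≈ idᵗ (m + n)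
  interchange : ∀ {l m n p q r} (f : Tm t G l m) (g : Tm t G m n) (h : Tm t G p q) (k : Tm t G q r) →
                (f ⨾ g) ⊗ (h ⨾ k) ≈ (f ⊗ h) ⨾ (g ⊗ k)
  ⊗-identityˡ : ∀ {m n} (f : Tm t G m n) → idᵗ 0 ⊗ f ≈ f
  ⊗-identityʳ : ∀ {m n} (f : Tm t G m n) →
                cast (ℕ.+-identityʳ m) (ℕ.+-identityʳ n) (f ⊗ idᵗ 0) ≈ f
  ⊗-assoc     : ∀ {m n p q r s} (f : Tm t G m n) (g : Tm t G p q) (h : Tm t G r s) →
                cast (ℕ.+-assoc m p r) (ℕ.+-assoc n q s) ((f ⊗ g) ⊗ h) ≈ f ⊗ (g ⊗ h)

  swap-natural    : ∀ {m n p q} (f : Tm t G m n) (g : Tm t G p q) →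
                    (f ⊗ g) ⨾ swap n q ≈ swap m p ⨾ (g ⊗ f)
  swap-involutive : ∀ m n → swap m n ⨾ swap n m ≈ idᵗ (m + n)
  swap-hexagon    : ∀ m n p →
                    cast (ℕ.+-assoc m n p) refl (swap m n ⊗ idᵗ p)
                      ⨾ cast (sym (ℕ.+-assoc n m p)) (sym (ℕ.+-assoc n p m)) (idᵗ n ⊗ swap m p)
                    ≈ swap m (n + p)

  Tr-tightening  : ∀ {tr : T t} {x l m n p} (g : Tm t G l m) (f : Tm t G (x + m) (x + n)) (h : Tm t G n p) →
                   Tr {tr = tr} x ((idᵗ x ⊗ g) ⨾ f ⨾ (idᵗ x ⊗ h)) ≈ g ⨾ Tr {tr = tr} x f ⨾ h
  Tr-sliding     : ∀ {tr : T t} {x y m n} (f : Tm t G (x + m) (y + n)) (g : Tm t G y x) →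
                   Tr {tr = tr} x (f ⨾ (g ⊗ idᵗ n)) ≈ Tr {tr = tr} y ((g ⊗ idᵗ m) ⨾ f)
  Tr-vanishing₀  : ∀ {tr : T t} {m n} (f : Tm t G m n) → Tr {tr = tr} 0 f ≈ f
  Tr-vanishing₊  : ∀ {tr : T t} x y {m n} (f : Tm t G ((x + y) + m) ((x + y) + n)) →
                   Tr {tr = tr} (x + y) f
                   ≈ Tr {tr = tr} y (Tr {tr = tr} x (cast (ℕ.+-assoc x y m) (ℕ.+-assoc x y n) f))
  Tr-superposing : ∀ {tr : T t} {x m n p q} (f : Tm t G (x + m) (x + n)) (g : Tm t G p q) →
                   Tr {tr = tr} x (cast (ℕ.+-assoc x m p) (ℕ.+-assoc x n q) (f ⊗ g))
                   ≈ Tr {tr = tr} x f ⊗ g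
  Tr-yanking     : ∀ {tr : T t} x → Tr {tr = tr} x (swap x x) ≈ idᵗ x

Tm-setoid : Bool → (ℕ → ℕ → Set) → ℕ → ℕ → Setoid 0ℓ 0ℓ
Tm-setoid t G m n = record
  { Carrier = Tm t G m n
  ; _≈_ = _≈_
  ; isEquivalence = record { refl = ≈-refl ; sym = ≈-sym ; trans = ≈-trans } }

module Circuits (𝔖 : Signature) where
  open Signature 𝔖

  data CGen : ℕ → ℕ → Set where
    prim  : ∀ p → CGen (dom p) (cod p)
    fork  : CGen 1 2
    join  : CGen 2 1
    intro : CGen 0 1
    elim  : CGen 1 0

  data SGen : ℕ → ℕ → Set where
    comb  : ∀ {m n} → CGen m n → SGen m n
    val   : (v : V) → .(v ≢ •) → SGen 0 1
    delay : SGen 1 1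

  CCirc : ℕ → ℕ → Set
  CCirc = Tm false CGen

  SCirc : ℕ → ℕ → Set
  SCirc = Tm true SGen

  SCirc-setoid : ℕ → ℕ → Setoid 0ℓ 0ℓ
  SCirc-setoid = Tm-setoid true SGen

  ⌜_⌝ : ∀ {m n} → CCirc m n → SCirc m n
  ⌜ gen g ⌝    = gen (comb g)
  ⌜ idᵗ n ⌝    = idᵗ n
  ⌜ f ⨾ g ⌝    = ⌜ f ⌝ ⨾ ⌜ g ⌝
  ⌜ f ⊗ g ⌝    = ⌜ f ⌝ ⊗ ⌜ g ⌝
  ⌜ swap m n ⌝ = swap m n

  -- The value • is the introduction generator.
  value : V → SCirc 0 1
  value v with v ≟ⱽ •
  ... | yes _  = gen (comb intro)
  ... | no v≢• = gen (val v v≢•)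

  -- Wirewise versions; in forkⁿ and joinⁿ the swaps bring the i-th copies together.
  valueⁿ : ∀ {n} → Vec V n → SCirc 0 n
  valueⁿ []      = idᵗ 0
  valueⁿ (v ∷ u) = value v ⊗ valueⁿ u

  delayⁿ : ∀ n → SCirc n n
  delayⁿ zero    = idᵗ 0
  delayⁿ (suc n) = gen delay ⊗ delayⁿ n

  forkⁿ : ∀ n → SCirc n (n + n)
  forkⁿ zero    = idᵗ 0
  forkⁿ (suc n) = (gen (comb fork) ⊗ forkⁿ n)
    ⨾ cast refl (cong suc (ℕ.+-assoc n 1 n)) (idᵗ 1 ⊗ (swap 1 n ⊗ idᵗ n))

  joinⁿ : ∀ n → SCirc (n + n) n
  joinⁿ zero    = idᵗ 0
  joinⁿ (suc n) = cast (cong suc (ℕ.+-assoc n 1 n)) refl (idᵗ 1 ⊗ (swap n 1 ⊗ idᵗ n))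
    ⨾ (gen (comb join) ⊗ joinⁿ n)

  reg : ∀ {n} → Vec V n → SCirc n n
  reg {n} v = (valueⁿ v ⊗ delayⁿ n) ⨾ joinⁿ n

  const : ∀ {n} → Vec V n → SCirc 0 n
  const {n} v = Tr n (cast (sym (ℕ.+-identityʳ n)) refl (reg v ⨾ forkⁿ n))

module Denotation {𝔖 : Signature} (ℐ : Interpretation 𝔖) where
  open Signature 𝔖
  open Interpretation ℐ
  open Circuits 𝔖
  open StreamFunctions ℐ

  ⟦_⟧ᶜ : ∀ {m n} → CGen m n → StreamFn m n
  ⟦ prim p ⟧ᶜ = lift ⟦ p ⟧ᴾ (⟦⟧ᴾ-monotone p)
  ⟦ fork ⟧ᶜ   = lift (λ v → v ++ v) (λ le → Pointwise.++⁺ le le)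
  ⟦ join ⟧ᶜ   = lift (λ { (x ∷ y ∷ []) → x ⊔ y ∷ [] })
    (λ { (p ∷ q ∷ []) → ∨-least (⊑-trans p (x≤x∨y _ _)) (⊑-trans q (y≤x∨y _ _)) ∷ [] })
  ⟦ intro ⟧ᶜ  = lift (λ _ → • ∷ []) (λ _ → ⊑ⁿ-refl)
  ⟦ elim ⟧ᶜ   = lift (λ _ → []) (λ _ → [])

  ⟦_⟧ᴳ : ∀ {m n} → SGen m n → StreamFn m n
  ⟦ comb g ⟧ᴳ  = ⟦ g ⟧ᶜ
  ⟦ val v _ ⟧ᴳ = mk (λ _ → (v ∷ []) ◂ ⊥ˢ 1) (λ _ _ → refl) (λ _ _ → ⊑ⁿ-refl)
  ⟦ delay ⟧ᴳ   = mk (λ σ → ⊥ⁿ 1 ◂ σ)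
    (λ { zero _ → refl ; (suc i) eq → eq (ℕ.n≤1+n i) })
    (λ { le zero → ⊑ⁿ-refl ; le (suc i) → le i })

  ⟦_⟧ : ∀ {m n} → SCirc m n → StreamFn m n
  ⟦ gen g ⟧    = ⟦ g ⟧ᴳ
  ⟦ idᵗ n ⟧    = idˢ n
  ⟦ f ⨾ g ⟧    = ⟦ f ⟧ ⨾ˢ ⟦ g ⟧
  ⟦ f ⊗ g ⟧    = ⟦ f ⟧ ⊗ˢ ⟦ g ⟧
  ⟦ swap m n ⟧ = swapˢ m n
  ⟦ Tr x f ⟧   = Trˢ {x} ⟦ f ⟧

-- The denotation is invariant under the equations of traced PROPs, so it
-- descends to the morphisms of the free symmetric traced PROP.

module Soundness {𝔖 : Signature} (ℐ : Interpretation 𝔖) where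
  open Signature 𝔖
  open Interpretation ℐ
  open Circuits 𝔖
  open StreamFunctions ℐ
  open Denotation ℐ
  open ≡-Reasoning

  take-++ : ∀ {m n} (u : Vec V m) (v : Vec V n) → take m (u ++ v) ≡ u
  take-++ []      v = refl
  take-++ (x ∷ u) v = cong (x ∷_) (take-++ u v)

  drop-++ : ∀ {m n} (u : Vec V m) (v : Vec V n) → drop m (u ++ v) ≡ v
  drop-++ []      v = refl
  drop-++ (x ∷ u) v = drop-++ u v

  module _ {p r : ℕ} where
    takeᵃ : ∀ m (w : Vec V (m + (p + r))) →
            take m (take (m + p) (Vec.cast (sym (ℕ.+-assoc m p r)) w)) ≡ take m w
    takeᵃ zero    w       = refl
    takeᵃ (suc m) (x ∷ w) = cong (x ∷_) (takeᵃ m w)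

    midᵃ : ∀ m (w : Vec V (m + (p + r))) →
           drop m (take (m + p) (Vec.cast (sym (ℕ.+-assoc m p r)) w)) ≡ take p (drop m w)
    midᵃ zero    w       = cong (take p) (Vec.cast-is-id refl w)
    midᵃ (suc m) (x ∷ w) = midᵃ m w

    dropᵃ : ∀ m (w : Vec V (m + (p + r))) →
            drop (m + p) (Vec.cast (sym (ℕ.+-assoc m p r)) w) ≡ drop p (drop m w)
    dropᵃ zero    w       = cong (drop p) (Vec.cast-is-id refl w)
    dropᵃ (suc m) (x ∷ w) = dropᵃ m w

    takeᵃ⁻ : ∀ m (w : Vec V ((m + p) + r)) →
             take m (Vec.cast (ℕ.+-assoc m p r) w) ≡ take m (take (m + p) w)
    takeᵃ⁻ zero    w       = refl
    takeᵃ⁻ (suc m) (x ∷ w) = cong (x ∷_) (takeᵃ⁻ m w)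

    dropᵃ⁻ : ∀ m (w : Vec V ((m + p) + r)) →
             drop m (Vec.cast (ℕ.+-assoc m p r) w) ≡ drop m (take (m + p) w) ++ drop (m + p) w
    dropᵃ⁻ zero    w       = trans (Vec.cast-is-id refl w) (sym (Vec.take++drop≡id p w))
    dropᵃ⁻ (suc m) (x ∷ w) = dropᵃ⁻ m w

  []-unique : (u : Vec V 0) → [] ≡ u
  []-unique [] = refl

  ⟦cast⟧ : ∀ {m m′ n n′} (p : m ≡ m′) (q : n ≡ n′) (f : SCirc m n) σ i →
           fn ⟦ cast p q f ⟧ σ i ≡ Vec.cast q (fn ⟦ f ⟧ (Vec.cast (sym p) ∘ σ) i)
  ⟦cast⟧ refl refl f σ i = begin
    fn ⟦ f ⟧ σ i                                 ≡⟨ fn-cong ⟦ f ⟧ (λ j → sym (Vec.cast-is-id refl (σ j))) i ⟩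
    fn ⟦ f ⟧ (Vec.cast refl ∘ σ) i               ≡⟨ sym (Vec.cast-is-id refl _) ⟩
    Vec.cast refl (fn ⟦ f ⟧ (Vec.cast refl ∘ σ) i) ∎

  μ-unique : ∀ {n} (F : StreamFn n n) τ → (∀ i → fn F τ i ≡ τ i) →
             (∀ υ → fn F υ ≤ˢ υ → τ ≤ˢ υ) → ∀ i → Fixpoint.μ F i ≡ τ i
  μ-unique F τ fixed least i = ⊑ⁿ-antisym
    (Fixpoint.μ-least-prefixed F τ (λ j → ⊑ⁿ-reflexive (fixed j)) i)
    (least _ (λ j → ⊑ⁿ-reflexive (Fixpoint.μ-fixed F j)) i)

  feedback-cong : ∀ {x m m′ n n′} (f : StreamFn (x + m) (x + n)) (g : StreamFn (x + m′) (x + n′)) σ σ′ →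
                  (∀ τ i → take x (fn f (τ ++ˢ σ) i) ≡ take x (fn g (τ ++ˢ σ′) i)) →
                  ∀ i → feedback {x} f σ i ≡ feedback {x} g σ′ i
  feedback-cong {x} f g σ σ′ eq i = μ-causal (loop {x} f σ) (loop {x} g σ′) i (λ τ {j} _ → eq τ j)

  sound : ∀ {m n} {f g : SCirc m n} → f ≈ g → fn ⟦ f ⟧ ≈ˢ fn ⟦ g ⟧
  sound ≈-refl σ i = refl
  sound (≈-sym p) σ i = sym (sound p σ i)
  sound (≈-trans p q) σ i = trans (sound p σ i) (sound q σ i)
  sound (⨾-cong {f = f} {f′} {g} {g′} p q) σ i =
    trans (fn-cong ⟦ g ⟧ (sound p σ) i) (sound q _ i)
  sound (⊗-cong p q) σ i = cong₂ _++_ (sound p _ i) (sound q _ i)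
  sound (Tr-cong {x = x} {f = f} {f′} p) σ i = cong (drop x) (begin
    fn ⟦ f ⟧ (feedback {x} ⟦ f ⟧ σ ++ˢ σ) i   ≡⟨ fn-cong ⟦ f ⟧ (λ j → cong (_++ σ j) (fb j)) i ⟩
    fn ⟦ f ⟧ (feedback {x} ⟦ f′ ⟧ σ ++ˢ σ) i  ≡⟨ sound p _ i ⟩
    fn ⟦ f′ ⟧ (feedback {x} ⟦ f′ ⟧ σ ++ˢ σ) i ∎)
    where
    fb = feedback-cong {x} ⟦ f ⟧ ⟦ f′ ⟧ σ σ (λ τ j → cong (take x) (sound p _ j))
  sound (⨾-identityˡ f) σ i = refl
  sound (⨾-identityʳ f) σ i = refl
  sound (⨾-assoc f g h) σ i = refl
  sound (⊗-id m n) σ i = Vec.take++drop≡id m (σ i)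
  sound (interchange f g h k) σ i = cong₂ _++_
    (fn-cong ⟦ g ⟧ (λ j → sym (take-++ (fn ⟦ f ⟧ _ j) _)) i)
    (fn-cong ⟦ k ⟧ (λ j → sym (drop-++ (fn ⟦ f ⟧ _ j) _)) i)
  sound (⊗-identityˡ f) σ i = refl
  sound (⊗-identityʳ {m} {n} f) σ i = begin
    fn ⟦ cast (ℕ.+-identityʳ m) (ℕ.+-identityʳ n) (f ⊗ idᵗ 0) ⟧ σ i
      ≡⟨ ⟦cast⟧ (ℕ.+-identityʳ m) (ℕ.+-identityʳ n) (f ⊗ idᵗ 0) σ i ⟩
    Vec.cast (ℕ.+-identityʳ n) (fn ⟦ f ⟧ σ₀ i ++ drop m (Vec.cast _ (σ i)))
      ≡⟨ cong (λ u → Vec.cast (ℕ.+-identityʳ n) (fn ⟦ f ⟧ σ₀ i ++ u)) (sym ([]-unique _)) ⟩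
    Vec.cast (ℕ.+-identityʳ n) (fn ⟦ f ⟧ σ₀ i ++ [])
      ≡⟨ Vec.++-identityʳ-eqFree _ ⟩
    fn ⟦ f ⟧ σ₀ i
      ≡⟨ fn-cong ⟦ f ⟧ (λ j → take₀ (σ j)) i ⟩
    fn ⟦ f ⟧ σ i ∎
    where
    σ₀ = take m ∘ Vec.cast (sym (ℕ.+-identityʳ m)) ∘ σ
    take₀ : ∀ {m} (v : Vec V m) → take m (Vec.cast (sym (ℕ.+-identityʳ m)) v) ≡ v
    take₀ []      = refl
    take₀ (x ∷ v) = cong (x ∷_) (take₀ v)
  sound (⊗-assoc {m} {n} {p} {q} {r} {s} f g h) σ i = begin
    fn ⟦ cast (ℕ.+-assoc m p r) (ℕ.+-assoc n q s) ((f ⊗ g) ⊗ h) ⟧ σ i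
      ≡⟨ ⟦cast⟧ (ℕ.+-assoc m p r) (ℕ.+-assoc n q s) ((f ⊗ g) ⊗ h) σ i ⟩
    Vec.cast (ℕ.+-assoc n q s) ((fn ⟦ f ⟧ (take m ∘ take (m + p) ∘ c) i
        ++ fn ⟦ g ⟧ (drop m ∘ take (m + p) ∘ c) i) ++ fn ⟦ h ⟧ (drop (m + p) ∘ c) i)
      ≡⟨ Vec.++-assoc-eqFree (fn ⟦ f ⟧ _ i) _ _ ⟩
    fn ⟦ f ⟧ (take m ∘ take (m + p) ∘ c) i
        ++ (fn ⟦ g ⟧ (drop m ∘ take (m + p) ∘ c) i ++ fn ⟦ h ⟧ (drop (m + p) ∘ c) i)
      ≡⟨ cong₂ _++_ (fn-cong ⟦ f ⟧ (takeᵃ m ∘ σ) i)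
           (cong₂ _++_ (fn-cong ⟦ g ⟧ (midᵃ m ∘ σ) i) (fn-cong ⟦ h ⟧ (dropᵃ m ∘ σ) i)) ⟩
    fn ⟦ f ⊗ (g ⊗ h) ⟧ σ i ∎
    where c = Vec.cast (sym (ℕ.+-assoc m p r)) ∘ σ
  sound (swap-natural {m} {n} {p} {q} f g) σ i = begin
    drop n (u ++ v) ++ take n (u ++ v)
      ≡⟨ cong₂ _++_ (drop-++ u v) (take-++ u v) ⟩
    v ++ u
      ≡⟨ cong₂ _++_ (fn-cong ⟦ g ⟧ (λ j → sym (take-++ (drop m (σ j)) _)) i)
                    (fn-cong ⟦ f ⟧ (λ j → sym (drop-++ (drop m (σ j)) _)) i) ⟩
    fn ⟦ swap m p ⨾ (g ⊗ f) ⟧ σ i ∎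
    where
    u = fn ⟦ f ⟧ (take m ∘ σ) i
    v = fn ⟦ g ⟧ (drop m ∘ σ) i
  sound (swap-involutive m n) σ i = begin
    drop n (b ++ a) ++ take n (b ++ a) ≡⟨ cong₂ _++_ (drop-++ b a) (take-++ b a) ⟩
    a ++ b                             ≡⟨ Vec.take++drop≡id m (σ i) ⟩
    σ i                                ∎
    where
    a = take m (σ i)
    b = drop m (σ i)
  sound (swap-hexagon m n p) σ i = begin
    fn ⟦ cast (sym e₁) (sym e₂) (idᵗ n ⊗ swap m p) ⟧ ρ i
      ≡⟨ ⟦cast⟧ (sym e₁) (sym e₂) (idᵗ n ⊗ swap m p) ρ i ⟩
    Vec.cast (sym e₂) (rot (Vec.cast (sym (sym e₁)) (ρ i)))
      ≡⟨ cong (Vec.cast (sym e₂) ∘ rot) (begin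
           Vec.cast (sym (sym e₁)) (ρ i)
             ≡⟨ cong (Vec.cast (sym (sym e₁))) (⟦cast⟧ e₀ refl (swap m n ⊗ idᵗ p) σ i) ⟩
           Vec.cast (sym (sym e₁)) (Vec.cast refl ((drop m (take (m + n) c) ++ take m (take (m + n) c)) ++ drop (m + n) c))
             ≡⟨ cong (Vec.cast (sym (sym e₁))) (Vec.cast-is-id refl _) ⟩
           Vec.cast (sym (sym e₁)) ((drop m (take (m + n) c) ++ take m (take (m + n) c)) ++ drop (m + n) c)
             ≡⟨ cong₂ (λ u w → Vec.cast (sym (sym e₁)) (u ++ w))
                  (cong₂ _++_ (midᵃ {n} {p} m (σ i)) (takeᵃ {n} {p} m (σ i))) (dropᵃ {n} {p} m (σ i)) ⟩
           Vec.cast (sym (sym e₁)) ((B ++ A) ++ C)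
             ≡⟨ Vec.++-assoc-eqFree B A C ⟩
           B ++ (A ++ C) ∎) ⟩
    Vec.cast (sym e₂) (rot (B ++ (A ++ C)))
      ≡⟨ cong (Vec.cast (sym e₂)) (cong₂ _++_ (take-++ B _)
           (cong₂ _++_ (trans (cong (drop m) (drop-++ B _)) (drop-++ A C))
                       (trans (cong (take m) (drop-++ B _)) (take-++ A C)))) ⟩
    Vec.cast (sym e₂) (B ++ (C ++ A))
      ≡⟨ Vec.cast-sym e₂ (Vec.++-assoc-eqFree B C A) ⟩
    (B ++ C) ++ A
      ≡⟨ cong (_++ A) (Vec.take++drop≡id n (drop m (σ i))) ⟩
    drop m (σ i) ++ take m (σ i) ∎
    where
    e₀ = ℕ.+-assoc m n p
    e₁ = ℕ.+-assoc n m p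
    e₂ = ℕ.+-assoc n p m
    ρ = fn ⟦ cast e₀ refl (swap m n ⊗ idᵗ p) ⟧ σ
    c = Vec.cast (sym e₀) (σ i)
    A = take m (σ i)
    B = take n (drop m (σ i))
    C = drop n (drop m (σ i))
    rot : Vec V (n + (m + p)) → Vec V (n + (p + m))
    rot w = take n w ++ (drop m (drop n w) ++ take m (drop n w))
  sound (Tr-tightening {x = x} {n = n} g f h) σ i = begin
    drop x (take x (F τ i) ++ fn ⟦ h ⟧ (drop x ∘ F τ) i)
      ≡⟨ drop-++ (take x (F τ i)) _ ⟩
    fn ⟦ h ⟧ (drop x ∘ F τ) i
      ≡⟨ fn-cong ⟦ h ⟧ (λ j → cong (drop x) (trans (F≡ τ j)
           (fn-cong ⟦ f ⟧ (λ l → cong (_++ fn ⟦ g ⟧ σ l) (fb l)) j))) i ⟩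
    fn ⟦ h ⟧ (drop x ∘ fn ⟦ f ⟧ (feedback {x} ⟦ f ⟧ (fn ⟦ g ⟧ σ) ++ˢ fn ⟦ g ⟧ σ)) i ∎
    where
    k = (idᵗ x ⊗ g) ⨾ f ⨾ (idᵗ x ⊗ h)
    F : Streamⁿ x → Streamⁿ (x + n)
    F υ = fn ⟦ f ⟧ (fn ⟦ idᵗ x ⊗ g ⟧ (υ ++ˢ σ))
    τ = feedback {x} ⟦ k ⟧ σ
    F≡ : ∀ υ j → F υ j ≡ fn ⟦ f ⟧ (υ ++ˢ fn ⟦ g ⟧ σ) j
    F≡ υ = fn-cong ⟦ f ⟧ (λ l → cong₂ _++_ (take-++ (υ l) (σ l))
             (fn-cong ⟦ g ⟧ (λ l′ → drop-++ (υ l′) (σ l′)) l))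
    fb = feedback-cong {x} ⟦ k ⟧ ⟦ f ⟧ σ (fn ⟦ g ⟧ σ)
      (λ υ j → trans (take-++ (take x (F υ j)) _) (cong (take x) (F≡ υ j)))
  sound (Tr-sliding {x = x} {y} f g) σ i = begin
    drop x (fn ⟦ g ⟧ (take y ∘ fn ⟦ f ⟧ (μ₁ ++ˢ σ)) i ++ drop y (fn ⟦ f ⟧ (μ₁ ++ˢ σ) i))
      ≡⟨ drop-++ (fn ⟦ g ⟧ _ i) _ ⟩
    drop y (fn ⟦ f ⟧ (μ₁ ++ˢ σ) i)
      ≡⟨ cong (drop y) (fn-cong ⟦ f ⟧ (λ j → cong (_++ σ j) (μ₁≡ j)) i) ⟩
    drop y (fn ⟦ f ⟧ (fn ⟦ g ⟧ μ₂ ++ˢ σ) i)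
      ≡⟨ cong (drop y) (sym (G≡ μ₂ i)) ⟩
    drop y (G μ₂ i) ∎
    where
    k₁ = f ⨾ (g ⊗ idᵗ _)
    k₂ = (g ⊗ idᵗ _) ⨾ f
    μ₁ = feedback {x} ⟦ k₁ ⟧ σ
    μ₂ = feedback {y} ⟦ k₂ ⟧ σ
    G : Streamⁿ y → Streamⁿ _
    G υ = fn ⟦ f ⟧ (fn ⟦ g ⊗ idᵗ _ ⟧ (υ ++ˢ σ))
    G≡ : ∀ υ j → G υ j ≡ fn ⟦ f ⟧ (fn ⟦ g ⟧ υ ++ˢ σ) j
    G≡ υ = fn-cong ⟦ f ⟧ (λ l → cong₂ _++_ (fn-cong ⟦ g ⟧ (λ l′ → take-++ (υ l′) (σ l′)) l)
             (drop-++ (υ l) (σ l)))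
    Φ : Streamⁿ x → Streamⁿ y
    Φ υ = take y ∘ fn ⟦ f ⟧ (υ ++ˢ σ)
    Φ-mono : ∀ {υ υ′} → υ ≤ˢ υ′ → Φ υ ≤ˢ Φ υ′
    Φ-mono le j = take⁺ y (monotone ⟦ f ⟧ (λ l → Pointwise.++⁺ (le l) ⊑ⁿ-refl) j)
    μ₂-fixed : ∀ j → Φ (fn ⟦ g ⟧ μ₂) j ≡ μ₂ j
    μ₂-fixed j = trans (cong (take y) (sym (G≡ μ₂ j))) (Fixpoint.μ-fixed (loop {y} ⟦ k₂ ⟧ σ) j)
    μ₂-least : ∀ υ → Φ (fn ⟦ g ⟧ υ) ≤ˢ υ → μ₂ ≤ˢ υ
    μ₂-least υ le = Fixpoint.μ-least-prefixed (loop {y} ⟦ k₂ ⟧ σ) υ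
      (λ j → ⊑ⁿ-trans (⊑ⁿ-reflexive (cong (take y) (G≡ υ j))) (le j))
    μ₁≡ : ∀ j → μ₁ j ≡ fn ⟦ g ⟧ μ₂ j
    μ₁≡ = μ-unique (loop {x} ⟦ k₁ ⟧ σ) (fn ⟦ g ⟧ μ₂)
      (λ j → trans (take-++ (fn ⟦ g ⟧ _ j) _) (fn-cong ⟦ g ⟧ μ₂-fixed j))
      (λ υ le → let gΦ≤υ = λ j → ⊑ⁿ-trans (⊑ⁿ-reflexive (sym (take-++ (fn ⟦ g ⟧ (Φ υ) j) _))) (le j) in
        λ j → ⊑ⁿ-trans (monotone ⟦ g ⟧ (μ₂-least (Φ υ) (Φ-mono gΦ≤υ)) j) (gΦ≤υ j))
  sound (Tr-vanishing₀ f) σ i =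
    fn-cong ⟦ f ⟧ (λ j → cong (_++ σ j) (sym ([]-unique (feedback {0} ⟦ f ⟧ σ j)))) i
  sound (Tr-vanishing₊ x y {m} {n} f) σ i = begin
    drop (x + y) (fn ⟦ f ⟧ (feedback {x + y} ⟦ f ⟧ σ ++ˢ σ) i)
      ≡⟨ cong (drop (x + y)) (fn-cong ⟦ f ⟧ (λ j → cong (_++ σ j) (μ≡ j)) i) ⟩
    drop (x + y) (fn ⟦ f ⟧ ((H μy ++ˢ μy) ++ˢ σ) i)
      ≡⟨ sym (drop-++ (drop x (take (x + y) w)) (drop (x + y) w)) ⟩
    drop y (drop x (take (x + y) w) ++ drop (x + y) w)
      ≡⟨ cong (drop y) (sym (drop-f′ (H μy) μy i)) ⟩
    drop y (drop x (fn ⟦ f′ ⟧ (H μy ++ˢ (μy ++ˢ σ)) i)) ∎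
    where
    f′ = cast (ℕ.+-assoc x y m) (ℕ.+-assoc x y n) f
    inner = Tr x f′
    H : Streamⁿ y → Streamⁿ x
    H υ = feedback {x} ⟦ f′ ⟧ (υ ++ˢ σ)
    μy = feedback {y} ⟦ inner ⟧ σ
    w = fn ⟦ f ⟧ ((H μy ++ˢ μy) ++ˢ σ) i
    f′≡ : ∀ α β j → fn ⟦ f′ ⟧ (α ++ˢ (β ++ˢ σ)) j
                    ≡ Vec.cast (ℕ.+-assoc x y n) (fn ⟦ f ⟧ ((α ++ˢ β) ++ˢ σ) j)
    f′≡ α β j = trans (⟦cast⟧ (ℕ.+-assoc x y m) (ℕ.+-assoc x y n) f (α ++ˢ (β ++ˢ σ)) j)
      (cong (Vec.cast _) (fn-cong ⟦ f ⟧
        (λ l → Vec.cast-sym (ℕ.+-assoc x y m) (Vec.++-assoc-eqFree (α l) (β l) (σ l))) j))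
    take-f′ : ∀ α β j → take x (fn ⟦ f′ ⟧ (α ++ˢ (β ++ˢ σ)) j)
                        ≡ take x (take (x + y) (fn ⟦ f ⟧ ((α ++ˢ β) ++ˢ σ) j))
    take-f′ α β j = trans (cong (take x) (f′≡ α β j)) (takeᵃ⁻ x _)
    drop-f′ : ∀ α β j → drop x (fn ⟦ f′ ⟧ (α ++ˢ (β ++ˢ σ)) j)
                        ≡ drop x (take (x + y) (fn ⟦ f ⟧ ((α ++ˢ β) ++ˢ σ) j))
                          ++ drop (x + y) (fn ⟦ f ⟧ ((α ++ˢ β) ++ˢ σ) j)
    drop-f′ α β j = trans (cong (drop x) (f′≡ α β j)) (dropᵃ⁻ x _)
    mid-f′ : ∀ α β j → take y (drop x (fn ⟦ f′ ⟧ (α ++ˢ (β ++ˢ σ)) j))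
                       ≡ drop x (take (x + y) (fn ⟦ f ⟧ ((α ++ˢ β) ++ˢ σ) j))
    mid-f′ α β j = trans (cong (take y) (drop-f′ α β j)) (take-++ _ _)
    fixed : ∀ j → take (x + y) (fn ⟦ f ⟧ ((H μy ++ˢ μy) ++ˢ σ) j) ≡ H μy j ++ μy j
    fixed j = trans (sym (Vec.take++drop≡id x _)) (cong₂ _++_
      (trans (sym (take-f′ (H μy) μy j)) (Fixpoint.μ-fixed (loop {x} ⟦ f′ ⟧ (μy ++ˢ σ)) j))
      (trans (sym (mid-f′ (H μy) μy j)) (Fixpoint.μ-fixed (loop {y} ⟦ inner ⟧ σ) j)))
    module _ (υ : Streamⁿ (x + y)) (le : take (x + y) ∘ fn ⟦ f ⟧ (υ ++ˢ σ) ≤ˢ υ) where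
      υx = take x ∘ υ
      υy = drop x ∘ υ
      le′ : ∀ j → take (x + y) (fn ⟦ f ⟧ ((υx ++ˢ υy) ++ˢ σ) j) ⊑ⁿ υ j
      le′ j = ⊑ⁿ-trans (⊑ⁿ-reflexive (cong (take (x + y))
        (fn-cong ⟦ f ⟧ (λ l → cong (_++ σ l) (Vec.take++drop≡id x (υ l))) j))) (le j)
      Hυy≤ : H υy ≤ˢ υx
      Hυy≤ = Fixpoint.μ-least-prefixed (loop {x} ⟦ f′ ⟧ (υy ++ˢ σ)) υx
        (λ j → ⊑ⁿ-trans (⊑ⁿ-reflexive (take-f′ υx υy j)) (take⁺ x (le′ j)))
      μy≤ : μy ≤ˢ υy
      μy≤ = Fixpoint.μ-least-prefixed (loop {y} ⟦ inner ⟧ σ) υy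
        (λ j → ⊑ⁿ-trans (take⁺ y (drop⁺ x (monotone ⟦ f′ ⟧ (λ l → Pointwise.++⁺ (Hυy≤ l) ⊑ⁿ-refl) j)))
                 (⊑ⁿ-trans (⊑ⁿ-reflexive (mid-f′ υx υy j)) (drop⁺ x (le′ j))))
      least : (H μy ++ˢ μy) ≤ˢ υ
      least j = ⊑ⁿ-trans (Pointwise.++⁺
          (⊑ⁿ-trans (feedback-monotone {x} ⟦ f′ ⟧ (λ l → Pointwise.++⁺ (μy≤ l) ⊑ⁿ-refl) j) (Hυy≤ j)) (μy≤ j))
        (⊑ⁿ-reflexive (Vec.take++drop≡id x (υ j)))
    μ≡ : ∀ j → feedback {x + y} ⟦ f ⟧ σ j ≡ H μy j ++ μy j
    μ≡ = μ-unique (loop {x + y} ⟦ f ⟧ σ) (H μy ++ˢ μy) fixed least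
  sound (Tr-superposing {x = x} {m} {n} {p} {q} f g) σ i = begin
    drop x (fn ⟦ k ⟧ (μ₁ ++ˢ σ) i)
      ≡⟨ cong (drop x) (fn-cong ⟦ k ⟧ (λ j → cong (_++ σ j) (μ≡ j)) i) ⟩
    drop x (fn ⟦ k ⟧ (μ₂ ++ˢ σ) i)
      ≡⟨ cong (drop x) (k≡ μ₂ i) ⟩
    drop x (Vec.cast (ℕ.+-assoc x n q) (fn ⟦ f ⟧ (μ₂ ++ˢ σm) i ++ fn ⟦ g ⟧ σp i))
      ≡⟨ dropᵃ⁻ x _ ⟩
    drop x (take (x + n) (fn ⟦ f ⟧ (μ₂ ++ˢ σm) i ++ fn ⟦ g ⟧ σp i))
      ++ drop (x + n) (fn ⟦ f ⟧ (μ₂ ++ˢ σm) i ++ fn ⟦ g ⟧ σp i)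
      ≡⟨ cong₂ _++_ (cong (drop x) (take-++ (fn ⟦ f ⟧ (μ₂ ++ˢ σm) i) _))
                    (drop-++ (fn ⟦ f ⟧ (μ₂ ++ˢ σm) i) _) ⟩
    drop x (fn ⟦ f ⟧ (μ₂ ++ˢ σm) i) ++ fn ⟦ g ⟧ σp i ∎
    where
    k = cast (ℕ.+-assoc x m p) (ℕ.+-assoc x n q) (f ⊗ g)
    σm = take m ∘ σ
    σp = drop m ∘ σ
    μ₁ = feedback {x} ⟦ k ⟧ σ
    μ₂ = feedback {x} ⟦ f ⟧ σm
    k≡ : ∀ τ j → fn ⟦ k ⟧ (τ ++ˢ σ) j
                 ≡ Vec.cast (ℕ.+-assoc x n q) (fn ⟦ f ⟧ (τ ++ˢ σm) j ++ fn ⟦ g ⟧ σp j)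
    k≡ τ j = trans (⟦cast⟧ (ℕ.+-assoc x m p) (ℕ.+-assoc x n q) (f ⊗ g) (τ ++ˢ σ) j)
      (cong (Vec.cast _) (cong₂ _++_
        (fn-cong ⟦ f ⟧ (λ l → trans (cong (take (x + m)) (split l)) (take-++ (τ l ++ σm l) _)) j)
        (fn-cong ⟦ g ⟧ (λ l → trans (cong (drop (x + m)) (split l)) (drop-++ (τ l ++ σm l) _)) j)))
      where
      split : ∀ l → Vec.cast (sym (ℕ.+-assoc x m p)) (τ l ++ σ l) ≡ (τ l ++ σm l) ++ σp l
      split l = trans (cong (λ u → Vec.cast (sym (ℕ.+-assoc x m p)) (τ l ++ u)) (sym (Vec.take++drop≡id m (σ l))))
        (Vec.cast-sym (ℕ.+-assoc x m p) (Vec.++-assoc-eqFree (τ l) (σm l) (σp l)))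
    μ≡ : ∀ j → μ₁ j ≡ μ₂ j
    μ≡ = feedback-cong {x} ⟦ k ⟧ ⟦ f ⟧ σ σm (λ τ j → trans (cong (take x) (k≡ τ j))
      (trans (takeᵃ⁻ x _) (cong (take x) (take-++ (fn ⟦ f ⟧ (τ ++ˢ σm) j) _))))
  sound (Tr-yanking x) σ i = begin
    drop x (drop x (μ i ++ σ i) ++ take x (μ i ++ σ i)) ≡⟨ drop-++ (drop x (μ i ++ σ i)) _ ⟩
    take x (μ i ++ σ i)                                 ≡⟨ take-++ (μ i) (σ i) ⟩
    μ i                                                 ≡⟨ sym (Fixpoint.μ-fixed (loop {x} ⟦ swap x x ⟧ σ) i) ⟩
    take x (drop x (μ i ++ σ i) ++ take x (μ i ++ σ i)) ≡⟨ take-++ (drop x (μ i ++ σ i)) _ ⟩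
    drop x (μ i ++ σ i)                                 ≡⟨ drop-++ (μ i) (σ i) ⟩
    σ i                                                 ∎
    where μ = feedback {x} ⟦ swap x x ⟧ σ

module Functions {𝔖 : Signature} (ℐ : Interpretation 𝔖) where
  open Signature 𝔖
  open Interpretation ℐ

  record FuncMor (m n : ℕ) : Set where
    field
      app      : Vec V m → Vec V n
      monotone : Monotone app
      bot      : app (⊥ⁿ m) ≡ ⊥ⁿ n

  open FuncMor public using (app)

-- A complete interpretation is a pair of ℐ and an inhabitant of Completeness ℐ.
record Completeness {𝔖 : Signature} (ℐ : Interpretation 𝔖) : Set where
  open Signature 𝔖
  open Circuits 𝔖
  open StreamFunctions ℐ using (fn)
  open Denotation ℐ using (⟦_⟧)
  open Functions ℐ

  field
    ‖_‖        : ∀ {m n} → FuncMor m n → SCirc m n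
    ‖‖-cong    : ∀ {m n} {f g : FuncMor m n} → (∀ v → app f v ≡ app g v) → ‖ f ‖ ≈ ‖ g ‖
    ‖‖-form    : ∀ {m n} (f : FuncMor m n) →
                 ∃[ k ] Σ[ v ∈ Vec V k ] Σ[ g ∈ CCirc (k + m) n ] ‖ f ‖ ≈ (const v ⊗ idᵗ m) ⨾ ⌜ g ⌝
    ‖‖-correct : ∀ {m n} (f : FuncMor m n) σ i → fn ⟦ ‖ f ‖ ⟧ σ i ≡ app f (σ i)

module Derivatives {𝔖 : Signature} (ℐ : Interpretation 𝔖) where
  open Signature 𝔖
  open Interpretation ℐ
  open StreamFunctions ℐ

  -- Any stream may follow a here: see initial-independent.
  initial : ∀ {m n} → StreamFn m n → Vec V m → Vec V n
  initial {m} f a = hd (fn f (a ◂ ⊥ˢ m))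

  initial-independent : ∀ {m n} (f : StreamFn m n) a σ → hd (fn f (a ◂ σ)) ≡ initial f a
  initial-independent f a σ = causal f 0 λ { z≤n → refl }

  deriv : ∀ {m n} → StreamFn m n → Vec V m → StreamFn m n
  deriv f a = mk (λ σ → tl (fn f (a ◂ σ)))
    (λ i eq → causal f (suc i) λ { {zero} _ → refl ; {suc j} (s≤s j≤i) → eq j≤i })
    (λ le i → monotone f (λ { zero → ⊑ⁿ-refl ; (suc j) → le j }) (suc i))

  data IsDerivative {m n} (f : StreamFn m n) : StreamFn m n → Set where
    base : IsDerivative f f
    step : ∀ {h} → IsDerivative f h → ∀ a → IsDerivative f (deriv h a)

  Derivative-setoid : ∀ {m n} → StreamFn m n → Setoid 0ℓ 0ℓ
  Derivative-setoid f = record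
    { Carrier = ∃ (IsDerivative f)
    ; _≈_ = λ h k → fn (proj₁ h) ≈ˢ fn (proj₁ k)
    ; isEquivalence = record
      { refl  = λ σ i → refl
      ; sym   = λ p σ i → sym (p σ i)
      ; trans = λ p q σ i → trans (p σ i) (q σ i) } }

  -- Two derivatives are identified when they agree pointwise.
  FinitelySpecified : ∀ {m n} → StreamFn m n → Set
  FinitelySpecified f = ∃ (IsEnumeration (Derivative-setoid f))

  record StreamMor (m n : ℕ) : Set where
    field
      streamFn          : StreamFn m n
      bot               : ∀ i → fn streamFn (⊥ˢ m) i ≡ ⊥ⁿ n
      finitelySpecified : FinitelySpecified streamFn

  open StreamMor public using (streamFn)

-- An initialised machine with finitely many states. The order is decidable, as
-- it classically always is on a finite set.
record Mealy {𝔖 : Signature} (ℐ : Interpretation 𝔖) (m n : ℕ) : Set₁ where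
  open Signature 𝔖
  open Interpretation ℐ
  infix 4 _≈ᴹ_ _≼_
  field
    State             : Set
    _≈ᴹ_ _≼_          : Rel State 0ℓ
    isDecPartialOrder : IsDecPartialOrder _≈ᴹ_ _≼_

  open IsDecPartialOrder isDecPartialOrder public
    using (_≟_; _≤?_; antisym; module Eq)
    renaming (refl to ≼-refl; trans to ≼-trans; reflexive to ≼-reflexive)

  state-setoid : Setoid 0ℓ 0ℓ
  state-setoid = record { isEquivalence = Eq.isEquivalence }

  field
    states          : List State
    states-complete : IsEnumeration state-setoid states
    step            : State → Vec V m → State × Vec V n
    step-monotone   : ∀ {s t u v} → s ≼ t → u ⊑ⁿ v →
                      proj₁ (step s u) ≼ proj₁ (step t v) × proj₂ (step s u) ⊑ⁿ proj₂ (step t v)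
    start           : State

  next : State → Vec V m → State
  next s a = proj₁ (step s a)

  output : State → Vec V m → Vec V n
  output s a = proj₂ (step s a)

  run : List (Vec V m) → State
  run = List.foldl next start

  next-cong : ∀ {s t} a → s ≈ᴹ t → next s a ≈ᴹ next t a
  next-cong a s≈t = antisym (proj₁ (step-monotone (≼-reflexive s≈t) ⊑ⁿ-refl))
                            (proj₁ (step-monotone (≼-reflexive (Eq.sym s≈t)) ⊑ⁿ-refl))

-- The pointwise order on the derivatives of a finitely specified function is
-- decided by searching for a simulation, i.e. a set of pairs of derivatives
-- closed under steps on which outputs are related.
module DecideOrder {𝔖 : Signature} (ℐ : Interpretation 𝔖) where
  open Signature 𝔖
  open Interpretation ℐ
  open StreamFunctions ℐ
  open Derivatives ℐ

  module _ {m n} (f : StreamFn m n) where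
    open Setoid (Derivative-setoid f) using () renaming (Carrier to S; _≈_ to _≈ᴰ_) public

    infix 4 _≼ᴰ_
    _≼ᴰ_ : Rel S 0ℓ
    h ≼ᴰ k = ∀ σ i → fn (proj₁ h) σ i ⊑ⁿ fn (proj₁ k) σ i

  private
    ∀Vec? : ∀ {n} {Q : Vec V n → Set} → (∀ v → Dec (Q v)) → Dec (∀ v → Q v)
    ∀Vec? {n} Q? = map′ (λ all v → All.lookup all (∈-allVecs v)) (λ q → All.tabulate (λ {v} _ → q v))
                        (All.all? Q? (allVecs n))

    ¬¬-dec-Fin : ∀ n (Q : Fin n → Set) → ¬ ¬ (∀ i → Dec (Q i))
    ¬¬-dec-Fin zero    Q k = k λ ()
    ¬¬-dec-Fin (suc n) Q k = ¬¬-excluded-middle λ d₀ → ¬¬-dec-Fin n (Q ∘ suc) λ ds →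
      k λ { zero → d₀ ; (suc i) → ds i }

  module _ {m n} {f : StreamFn m n} (enum : FinitelySpecified f) where
    private
      pairs : List (S f × S f)
      pairs = List.cartesianProduct (proj₁ enum) (proj₁ enum)

      N = List.length pairs

      pairs-complete : IsEnumeration (Derivative-setoid f ×ₛ Derivative-setoid f) pairs
      pairs-complete = Enumerates.cartesianProduct⁺ (Derivative-setoid f) (Derivative-setoid f) (proj₂ enum) (proj₂ enum)

      left right : Fin N → S f
      left p  = proj₁ (List.lookup pairs p)
      right p = proj₂ (List.lookup pairs p)

      index : S f → S f → Fin N
      index h k = Any.index (pairs-complete (h , k))

      left-index : ∀ h k → fn (proj₁ h) ≈ˢ fn (proj₁ (left (index h k)))
      left-index h k = proj₁ (Any.lookup-index (pairs-complete (h , k)))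

      right-index : ∀ h k → fn (proj₁ k) ≈ˢ fn (proj₁ (right (index h k)))
      right-index h k = proj₂ (Any.lookup-index (pairs-complete (h , k)))

      derivᴰ : S f → Vec V m → S f
      derivᴰ (h , d) a = deriv h a , step d a

      nextᵖ : Fin N → Vec V m → Fin N
      nextᵖ p a = index (derivᴰ (left p) a) (derivᴰ (right p) a)

      OutputsRelated : Fin N → Vec V m → Set
      OutputsRelated p a = initial (proj₁ (left p)) a ⊑ⁿ initial (proj₁ (right p)) a

      Related : Fin N → Set
      Related p = _≼ᴰ_ f (left p) (right p)

      IsSimulation : Subset N → Set
      IsSimulation R = ∀ p → p Subset.∈ R → ∀ a → OutputsRelated p a × nextᵖ p a Subset.∈ R

      simulation? : ∀ R → Dec (IsSimulation R)
      simulation? R = Fin.all? λ p → (p Subset.∈? R) →-dec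
        ∀Vec? λ a → (initial (proj₁ (left p)) a ⊑ⁿ? initial (proj₁ (right p)) a)
                    ×-dec (nextᵖ p a Subset.∈? R)

      simulation⇒related : ∀ R → IsSimulation R → ∀ i p → p Subset.∈ R → ∀ σ →
                           fn (proj₁ (left p)) σ i ⊑ⁿ fn (proj₁ (right p)) σ i
      simulation⇒related R sim zero p p∈R σ =
        ⊑ⁿ-trans (⊑ⁿ-reflexive (causal (proj₁ (left p)) 0 λ { z≤n → refl }))
        (⊑ⁿ-trans (proj₁ (sim p p∈R (σ 0)))
        (⊑ⁿ-reflexive (causal (proj₁ (right p)) 0 λ { z≤n → refl })))
      simulation⇒related R sim (suc i) p p∈R σ =
        ⊑ⁿ-trans (⊑ⁿ-reflexive (trans (unfold (proj₁ (left p))) (left-index (derivᴰ (left p) (σ 0)) _ (tl σ) i)))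
        (⊑ⁿ-trans (simulation⇒related R sim i (nextᵖ p (σ 0)) (proj₂ (sim p p∈R (σ 0))) (tl σ))
        (⊑ⁿ-reflexive (sym (trans (unfold (proj₁ (right p))) (right-index _ (derivᴰ (right p) (σ 0)) (tl σ) i)))))
        where
        unfold : ∀ h → fn h σ (suc i) ≡ fn (deriv h (σ 0)) (tl σ) i
        unfold h = fn-cong h (λ { zero → refl ; (suc j) → refl }) (suc i)

      related⇒outputs : ∀ p → Related p → ∀ a → OutputsRelated p a
      related⇒outputs p rel a = rel (a ◂ ⊥ˢ m) 0

      related⇒next : ∀ p → Related p → ∀ a → Related (nextᵖ p a)
      related⇒next p rel a σ i =
        ⊑ⁿ-trans (⊑ⁿ-reflexive (sym (left-index (derivᴰ (left p) a) (derivᴰ (right p) a) σ i)))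
        (⊑ⁿ-trans (rel (a ◂ σ) (suc i))
        (⊑ⁿ-reflexive (right-index (derivᴰ (left p) a) (derivᴰ (right p) a) σ i)))

      related-simulation : (dec : ∀ p → Dec (Related p)) → Subset N
      related-simulation dec = Vec.tabulate (does ∘ dec)

      related⇒∈ : ∀ dec p → Related p → p Subset.∈ related-simulation dec
      related⇒∈ dec p rel = Vec.lookup⇒[]= p _
        (trans (Vec.lookup∘tabulate (does ∘ dec) p) (dec-true (dec p) rel))

      ∈⇒related : ∀ dec p → p Subset.∈ related-simulation dec → Related p
      ∈⇒related dec p p∈R with dec p in eq
      ... | yes rel = rel
      ... | no ¬rel = contradiction
        (trans (sym (Vec.[]=⇒lookup p∈R)) (trans (Vec.lookup∘tabulate (does ∘ dec) p) (cong does eq))) λ ()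

      related? : ∀ p → Dec (Related p)
      related? p with Subset.anySubset? (λ R → (p Subset.∈? R) ×-dec simulation? R)
      ... | yes (R , p∈R , sim) = yes λ σ i → simulation⇒related R sim i p p∈R σ
      ... | no none = no λ rel → ¬¬-dec-Fin N Related λ dec →
        none (related-simulation dec , related⇒∈ dec p rel , λ q q∈R a →
          related⇒outputs q (∈⇒related dec q q∈R) a ,
          related⇒∈ dec (nextᵖ q a) (related⇒next q (∈⇒related dec q q∈R) a))

    ≼ᴰ-dec : Decidable (_≼ᴰ_ f)
    ≼ᴰ-dec h k = map′
      (λ rel σ i → ⊑ⁿ-trans (⊑ⁿ-reflexive (left-index h k σ i))
                   (⊑ⁿ-trans (rel σ i) (⊑ⁿ-reflexive (sym (right-index h k σ i)))))
      (λ le σ i → ⊑ⁿ-trans (⊑ⁿ-reflexive (sym (left-index h k σ i)))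
                  (⊑ⁿ-trans (le σ i) (⊑ⁿ-reflexive (right-index h k σ i))))
      (related? (index h k))

  ≼ᴰ-antisym : ∀ {m n} {f : StreamFn m n} {h k} → _≼ᴰ_ f h k → _≼ᴰ_ f k h → _≈ᴰ_ f h k
  ≼ᴰ-antisym p q σ i = ⊑ⁿ-antisym (p σ i) (q σ i)

  abstract
    ≼ᴰ-isDecPartialOrder : ∀ {m n} {f : StreamFn m n} → FinitelySpecified f →
                           IsDecPartialOrder (_≈ᴰ_ f) (_≼ᴰ_ f)
    ≼ᴰ-isDecPartialOrder {f = f} enum = record
      { isPartialOrder = record
        { isPreorder = record
          { isEquivalence = Setoid.isEquivalence (Derivative-setoid f)
          ; reflexive = λ eq σ i → ⊑ⁿ-reflexive (eq σ i)
          ; trans = λ p q σ i → ⊑ⁿ-trans (p σ i) (q σ i) }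
        ; antisym = λ {h} {k} → ≼ᴰ-antisym {f = f} {h} {k} }
      ; _≟_ = λ h k → map′ (λ (p , q) → ≼ᴰ-antisym {f = f} {h} {k} p q)
          (λ eq → (λ σ i → ⊑ⁿ-reflexive (eq σ i)) , (λ σ i → ⊑ⁿ-reflexive (sym (eq σ i))))
          (≼ᴰ-dec enum h k ×-dec ≼ᴰ-dec enum k h)
      ; _≤?_ = ≼ᴰ-dec enum }

module ToMealy {𝔖 : Signature} (ℐ : Interpretation 𝔖) where
  open Interpretation ℐ
  open StreamFunctions ℐ
  open Derivatives ℐ
  open DecideOrder ℐ

  ⟪_⟫ : ∀ {m n} → StreamMor m n → Mealy ℐ m n
  ⟪_⟫ {m} f = record
    { State             = ∃ (IsDerivative (streamFn f))
    ; _≈ᴹ_              = _≈ᴰ_ (streamFn f)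
    ; _≼_               = _≼ᴰ_ (streamFn f)
    ; isDecPartialOrder = ≼ᴰ-isDecPartialOrder (StreamMor.finitelySpecified f)
    ; states            = proj₁ (StreamMor.finitelySpecified f)
    ; states-complete   = proj₂ (StreamMor.finitelySpecified f)
    ; step              = λ (h , d) a → (deriv h a , step d a) , initial h a
    ; step-monotone     = λ {s} {t} {u} {v} h≼k u⊑v →
        (λ σ i → ⊑ⁿ-trans (h≼k (u ◂ σ) (suc i)) (monotone (proj₁ t) (◂-mono u⊑v σ) (suc i))) ,
        ⊑ⁿ-trans (h≼k (u ◂ ⊥ˢ m) 0) (monotone (proj₁ t) (◂-mono u⊑v (⊥ˢ m)) 0)
    ; start             = streamFn f , base }
    where
    ◂-mono : ∀ {n} {u v} → u ⊑ⁿ v → (σ : Streamⁿ n) → (u ◂ σ) ≤ˢ (v ◂ σ)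
    ◂-mono u⊑v σ zero    = u⊑v
    ◂-mono u⊑v σ (suc i) = ⊑ⁿ-refl

module WordOrder (𝔖 : Signature) {_≤_ : Rel (Signature.V 𝔖) 0ℓ} (tot : IsTotalOrder _≡_ _≤_) where
  open Signature 𝔖

  -- V^m is ordered lexicographically; words are ordered by length first and
  -- words of equal length lexicographically.
  Word : ℕ → Set
  Word m = List (Vec V m)

  _<ⱽ_ : Rel V 0ℓ
  _<ⱽ_ = ToStrict._<_ _≡_ _≤_

  _<ⁿ_ : ∀ {m} → Rel (Vec V m) 0ℓ
  _<ⁿ_ = VecLex.Lex-< _≡_ _<ⱽ_

  infix 4 _<ʷ_
  _<ʷ_ : ∀ {m} → Rel (Word m) 0ℓ
  _<ʷ_ = ×Lex.×-Lex _≡_ ℕ._<_ (ListLex.Lex-< _≡_ _<ⁿ_) on (λ w → List.length w , w)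

  private
    ≡-isStrictTotalOrder : ∀ {A : Set} {_≋_ _<_ : Rel A 0ℓ} → (∀ {x y} → x ≋ y → x ≡ y) →
                           IsStrictTotalOrder _≋_ _<_ → IsStrictTotalOrder _≡_ _<_
    ≡-isStrictTotalOrder {_≋_ = _≋_} {_<_} ≋⇒≡ sto = record
      { isStrictPartialOrder = record
        { isEquivalence = isEquivalence
        ; irrefl = λ { refl → irrefl Eq.refl }
        ; trans = <-trans
        ; <-resp-≈ = (λ { refl p → p }) , (λ { refl p → p }) }
      ; compare = λ x y → lower (compare x y) }
      where
      open IsStrictTotalOrder sto using (irrefl; compare; module Eq) renaming (trans to <-trans)
      lower : ∀ {x y} → Tri (x < y) (x ≋ y) (y < x) → Tri (x < y) (x ≡ y) (y < x)
      lower (tri< a b c) = tri< a (λ { refl → b Eq.refl }) c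
      lower (tri≈ a b c) = tri≈ a (≋⇒≡ b) c
      lower (tri> a b c) = tri> a (λ { refl → b Eq.refl }) c

    ListLex-isStrictTotalOrder : ∀ {A : Set} {_<_ : Rel A 0ℓ} → IsStrictTotalOrder _≡_ _<_ →
                                 IsStrictTotalOrder (ListPointwise.Pointwise _≡_) (ListLex.Lex-< _≡_ _<_)
    ListLex-isStrictTotalOrder sto =
      StrictTotalOrder.isStrictTotalOrder (ListLex.<-strictTotalOrder (record { isStrictTotalOrder = sto }))

  <ⱽ-isStrictTotalOrder : IsStrictTotalOrder _≡_ _<ⱽ_
  <ⱽ-isStrictTotalOrder = ToStrict.<-isStrictTotalOrder₁ _≡_ _≤_ _≟ⱽ_ tot

  <ⁿ-isStrictTotalOrder : ∀ {m} → IsStrictTotalOrder _≡_ (_<ⁿ_ {m})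
  <ⁿ-isStrictTotalOrder =
    ≡-isStrictTotalOrder Pointwise.Pointwise-≡⇒≡ (VecLex.<-isStrictTotalOrder <ⱽ-isStrictTotalOrder)

  <ʷ-isStrictTotalOrder : ∀ {m} → IsStrictTotalOrder _≡_ (_<ʷ_ {m})
  <ʷ-isStrictTotalOrder = ≡-isStrictTotalOrder (ListPointwise.Pointwise-≡⇒≡ ∘ proj₂)
    (On.isStrictTotalOrder (λ w → List.length w , w)
      (×Lex.×-isStrictTotalOrder ℕ.<-isStrictTotalOrder (ListLex-isStrictTotalOrder <ⁿ-isStrictTotalOrder)))

  <ʷ-strictTotalOrder : ℕ → StrictTotalOrder 0ℓ 0ℓ 0ℓ
  <ʷ-strictTotalOrder m = record { isStrictTotalOrder = <ʷ-isStrictTotalOrder {m} }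

module AccessibleStates (𝔖 : Signature) {_≤_ : Rel (Signature.V 𝔖) 0ℓ} (tot : IsTotalOrder _≡_ _≤_)
                        {ℐ : Interpretation 𝔖} {m n : ℕ} (M : Mealy ℐ m n) where
  open Signature 𝔖
  open WordOrder 𝔖 tot
  open Mealy M

  -- The accessible states q₀, …, q_{k-1}, each represented once, by its minimal
  -- word; the words increase, so the states come in the order of these words.
  record Listing : Set where
    field
      words      : List (Word m)
      increasing : AllPairs _<ʷ_ words
      minimal    : All (λ w → ∀ u → run u ≈ᴹ run w → ¬ u <ʷ w) words
      complete   : ∀ u → Any (λ w → run u ≈ᴹ run w) words

    size : ℕ
    size = List.length words

    q : Fin size → State
    q i = run (List.lookup words i)

  private
    K = List.length states

    index : State → Fin K
    index s = Any.index (states-complete s)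

    index-injective : ∀ {s t} → index s ≡ index t → s ≈ᴹ t
    index-injective {s} {t} eq = Eq.trans (Any.lookup-index (states-complete s))
      (subst (λ i → List.lookup states i ≈ᴹ t) (sym eq) (Eq.sym (Any.lookup-index (states-complete t))))

    foldl-cong : ∀ {s t} w → s ≈ᴹ t → List.foldl next s w ≈ᴹ List.foldl next t w
    foldl-cong []      s≈t = s≈t
    foldl-cong (a ∷ w) s≈t = foldl-cong w (next-cong a s≈t)

    -- A word visiting more than K states contains a cycle, which is cut out.
    shorten : ∀ w → K ℕ.≤ List.length w →
              Σ[ u ∈ Word m ] List.length u ℕ.< List.length w × run w ≈ᴹ run u
    shorten w K≤∣w∣ with Fin.pigeonhole (ℕ.n<1+n K) (λ i → index (run (List.take (toℕ i) w)))
    ... | i , j , i<j , eq = u , ∣u∣<∣w∣ , run-w≈run-u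
      where
      u = List.take (toℕ i) w List.++ List.drop (toℕ j) w
      j≤∣w∣ : toℕ j ℕ.≤ List.length w
      j≤∣w∣ = ℕ.≤-trans (ℕ.≤-pred (Fin.toℕ<n j)) K≤∣w∣
      ∣u∣<∣w∣ : List.length u ℕ.< List.length w
      ∣u∣<∣w∣ = begin
        suc (List.length u)
          ≡⟨ cong suc (trans (List.length-++ (List.take (toℕ i) w))
                 (cong₂ _+_ (List.length-take (toℕ i) w) (List.length-drop (toℕ j) w))) ⟩
        suc (toℕ i ℕ.⊓ List.length w + (List.length w ∸ toℕ j))
          ≤⟨ ℕ.+-monoˡ-≤ (List.length w ∸ toℕ j) (ℕ.≤-trans (s≤s (ℕ.m⊓n≤m (toℕ i) _)) i<j) ⟩
        toℕ j + (List.length w ∸ toℕ j)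
          ≡⟨ ℕ.m+[n∸m]≡n j≤∣w∣ ⟩
        List.length w ∎
        where open ℕ.≤-Reasoning
      run-w≈run-u : run w ≈ᴹ run u
      run-w≈run-u = subst₂ _≈ᴹ_
        (trans (sym (List.foldl-++ next start (List.take (toℕ j) w) _)) (cong run (List.take++drop≡id (toℕ j) w)))
        (sym (List.foldl-++ next start (List.take (toℕ i) w) (List.drop (toℕ j) w)))
        (foldl-cong (List.drop (toℕ j) w) (Eq.sym (index-injective eq)))

    shorter : ∀ w → Acc ℕ._<_ (List.length w) →
              Σ[ u ∈ Word m ] List.length u ℕ.≤ K × run w ≈ᴹ run u
    shorter w (acc rs) with List.length w ℕ.≤? K
    ... | yes ∣w∣≤K = w , ∣w∣≤K , Eq.refl
    ... | no ∣w∣≰K with shorten w (ℕ.<⇒≤ (ℕ.≰⇒> ∣w∣≰K))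
    ...   | u , ∣u∣<∣w∣ , w≈u with shorter u (rs ∣u∣<∣w∣)
    ...     | v , ∣v∣≤K , u≈v = v , ∣v∣≤K , Eq.trans w≈u u≈v

    wordsUpTo : ℕ → List (Word m)
    wordsUpTo zero    = [] ∷ []
    wordsUpTo (suc d) = [] ∷ List.cartesianProductWith _∷_ (allVecs m) (wordsUpTo d)

    ∈-wordsUpTo : ∀ d w → List.length w ℕ.≤ d → w List.∈ wordsUpTo d
    ∈-wordsUpTo zero    []      _         = here refl
    ∈-wordsUpTo (suc d) []      _         = here refl
    ∈-wordsUpTo (suc d) (a ∷ w) (s≤s w≤d) =
      there (List.∈-cartesianProductWith⁺ _∷_ (∈-allVecs a) (∈-wordsUpTo d w w≤d))

    module Sto = IsStrictTotalOrder (<ʷ-isStrictTotalOrder {m})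
    module Dto = STO (<ʷ-strictTotalOrder m)
    module Sort = ListSort Dto.decTotalOrder
    module Extrema = ListExtrema Dto.totalOrder

    <ʷ⇒length≤ : ∀ {u w : Word m} → u <ʷ w → List.length u ℕ.≤ List.length w
    <ʷ⇒length≤ (inj₁ lt)       = ℕ.<⇒≤ lt
    <ʷ⇒length≤ (inj₂ (eq , _)) = ℕ.≤-reflexive eq

    ≤⇒≯ : ∀ {u w : Word m} → u Dto.≤ w → ¬ w <ʷ u
    ≤⇒≯ (inj₁ u<w)  w<u = Sto.irrefl refl (Sto.trans u<w w<u)
    ≤⇒≯ (inj₂ refl) u<u = Sto.irrefl refl u<u

    minimalWord : ∀ w → Σ[ u ∈ Word m ] run w ≈ᴹ run u × (∀ v → run v ≈ᴹ run u → ¬ v <ʷ u)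
    minimalWord w = u , w≈u , minimal
      where
      candidate? = λ v → run w ≟ run v
      candidates = List.filter candidate? (wordsUpTo (List.length w))
      u = Extrema.min w candidates
      w≈u : run w ≈ᴹ run u
      w≈u = Extrema.argmin-all id {P = λ v → run w ≈ᴹ run v} Eq.refl (All.all-filter candidate? (wordsUpTo (List.length w)))
      u≤w : List.length u ℕ.≤ List.length w
      u≤w with Extrema.min≤⊤ w candidates
      ... | inj₁ u<w = <ʷ⇒length≤ u<w
      ... | inj₂ u≡w = ℕ.≤-reflexive (cong List.length u≡w)
      minimal : ∀ v → run v ≈ᴹ run u → ¬ v <ʷ u
      minimal v v≈u v<u = ≤⇒≯ (All.lookup (Extrema.min≤xs w candidates)
        (List.∈-filter⁺ candidate? (∈-wordsUpTo _ v (ℕ.≤-trans (<ʷ⇒length≤ v<u) u≤w))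
          (Eq.trans w≈u (Eq.sym v≈u)))) v<u

    _≟ʷ_ : DecidableEquality (Word m)
    _≟ʷ_ = List.≡-dec _≟ⁿ_

  private
    listing′ : Listing
    listing′ = record
      { words      = ws
      ; increasing = AllPairs.zipWith strict (Linked.Linked⇒AllPairs Dto.trans (Sort.sort-↗ ws₁) , unique)
      ; minimal    = Perm.All-resp-↭ (↭-sym (Sort.sort-↭ ws₁)) (All.tabulate λ w∈ws₁ →
          minimal-∈ (List.∈-map⁻ minWord (List.∈-deduplicate⁻ _≟ʷ_ ws₀ w∈ws₁)))
      ; complete   = complete }
      where
      minWord : Word m → Word m
      minWord w = proj₁ (minimalWord w)
      ws₀ = List.map minWord (wordsUpTo K)
      ws₁ = List.deduplicate _≟ʷ_ ws₀
      ws  = Sort.sort ws₁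
      unique : AllPairs _≢_ ws
      unique = PermSetoid.Unique-resp-↭ (setoid (Word m)) (↭⇒↭ₛ (↭-sym (Sort.sort-↭ ws₁))) (Unique.deduplicate-! _≟ʷ_ ws₀)
      strict : ∀ {u v} → u Dto.≤ v × u ≢ v → u <ʷ v
      strict (inj₁ u<v , _)   = u<v
      strict (inj₂ u≡v , u≢v) = contradiction u≡v u≢v
      minimal-∈ : ∀ {w} → (∃ λ v → v List.∈ wordsUpTo K × w ≡ minWord v) →
                  ∀ u → run u ≈ᴹ run w → ¬ u <ʷ w
      minimal-∈ (v , _ , refl) = proj₂ (proj₂ (minimalWord v))
      complete : ∀ u → Any (λ w → run u ≈ᴹ run w) ws
      complete u with shorter u (ℕ.<-wellFounded _)
      ... | v , ∣v∣≤K , u≈v = List.lose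
        (Perm.∈-resp-↭ (↭-sym (Sort.sort-↭ ws₁)) (List.∈-deduplicate⁺ _≟ʷ_ (List.∈-map⁺ minWord (∈-wordsUpTo K v ∣v∣≤K))))
        (Eq.trans u≈v (proj₁ (proj₂ (minimalWord v))))

  abstract
    listing : Listing
    listing = listing′

module Completion {𝔖 : Signature} (ℐ : Interpretation 𝔖) where
  open Signature 𝔖
  open Interpretation ℐ

  ⋁ : ∀ {n} → List (Vec V n) → Vec V n
  ⋁ {n} = List.foldr _⊔ⁿ_ (⊥ⁿ n)

  ⋁-upper : ∀ {n} {v : Vec V n} {vs} → v List.∈ vs → v ⊑ⁿ ⋁ vs
  ⋁-upper (here refl)       = ⊔ⁿ-upperˡ _ _
  ⋁-upper (there {x = u} v∈) = ⊑ⁿ-trans (⋁-upper v∈) (⊔ⁿ-upperʳ u _)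

  ⋁-least : ∀ {n} {v : Vec V n} vs → (∀ {u} → u List.∈ vs → u ⊑ⁿ v) → ⋁ vs ⊑ⁿ v
  ⋁-least []       below = ⊥ⁿ-least _
  ⋁-least (u ∷ vs) below = ⊔ⁿ-least (below (here refl)) (⋁-least vs (below ∘ there))

  module _ {b c : ℕ} {A : Vec V b → Set} (A? : Unary.Decidable A) (h : ∀ v → A v → Vec V c) where

    strictlyBelow : Vec V b → List (Vec V b)
    strictlyBelow v = List.filter (_⊏ⁿ? v) (allVecs b)

    private
      strictlyBelow-⊏ : ∀ {v w} → w List.∈ strictlyBelow v → w ⊏ⁿ v
      strictlyBelow-⊏ {v} w∈ = proj₂ (List.∈-filter⁻ (_⊏ⁿ? v) {xs = allVecs b} w∈)

    completionStep : ∀ v → (∀ {w} → w ⊏ⁿ v → Vec V c) → Vec V c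
    completionStep v rec with A? v | v ≟ⁿ ⊥ⁿ b
    ... | yes v∈A | _     = h v v∈A
    ... | no _    | yes _ = ⊥ⁿ c
    ... | no _    | no _  = ⋁ (List.mapWith∈ (strictlyBelow v) (λ w∈ → rec (strictlyBelow-⊏ w∈)))

    private
      step-ext : ∀ v {rec rec′ : ∀ {w} → w ⊏ⁿ v → Vec V c} →
                 (∀ {w} (w⊏v : w ⊏ⁿ v) → rec w⊏v ≡ rec′ w⊏v) → completionStep v rec ≡ completionStep v rec′
      step-ext v eq with A? v | v ≟ⁿ ⊥ⁿ b
      ... | yes _ | _     = refl
      ... | no _  | yes _ = refl
      ... | no _  | no _  = cong ⋁ (List.mapWith∈-cong (strictlyBelow v) _ _ (λ w∈ → eq (strictlyBelow-⊏ w∈)))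

    -- The defining equations follow: completion-⊥, completion-∉ and completion-∈.
    abstract
      completion : Vec V b → Vec V c
      completion = WF.All.wfRec ⊏ⁿ-wellFounded 0ℓ (λ _ → Vec V c) completionStep

      completion-unfold : ∀ v → completion v ≡ completionStep v (λ {w} _ → completion w)
      completion-unfold v = WF.FixPoint.unfold-wfRec ⊏ⁿ-wellFounded (λ _ → Vec V c) completionStep step-ext

    completion-⊥ : ¬ A (⊥ⁿ b) → completion (⊥ⁿ b) ≡ ⊥ⁿ c
    completion-⊥ ⊥∉A = trans (completion-unfold (⊥ⁿ b)) lemma where
      lemma : ∀ {rec : ∀ {w} → w ⊏ⁿ ⊥ⁿ b → Vec V c} → completionStep (⊥ⁿ b) rec ≡ ⊥ⁿ c
      lemma with A? (⊥ⁿ b) | ⊥ⁿ b ≟ⁿ ⊥ⁿ b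
      ... | yes ⊥∈A | _      = contradiction ⊥∈A ⊥∉A
      ... | no _    | yes _  = refl
      ... | no _    | no neq = contradiction refl neq

    completion-∉ : ∀ {v} → ¬ A v → v ≢ ⊥ⁿ b → completion v ≡ ⋁ (List.map completion (strictlyBelow v))
    completion-∉ {v} v∉A v≢⊥ = trans (completion-unfold v) lemma where
      lemma : completionStep v (λ {w} _ → completion w) ≡ ⋁ (List.map completion (strictlyBelow v))
      lemma with A? v | v ≟ⁿ ⊥ⁿ b
      ... | yes v∈A | _       = contradiction v∈A v∉A
      ... | no _    | yes v≡⊥ = contradiction v≡⊥ v≢⊥
      ... | no _    | no _    = cong ⋁ (List.mapWith∈≗map completion (strictlyBelow v))

    module _ (h-monotone : ∀ {u v} (u∈A : A u) (v∈A : A v) → u ⊑ⁿ v → h u u∈A ⊑ⁿ h v v∈A) where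

      completion-∈ : ∀ {v} (v∈A : A v) → completion v ≡ h v v∈A
      completion-∈ {v} v∈A = trans (completion-unfold v) lemma where
        lemma : ∀ {rec : ∀ {w} → w ⊏ⁿ v → Vec V c} → completionStep v rec ≡ h v v∈A
        lemma with A? v | v ≟ⁿ ⊥ⁿ b
        ... | yes v∈A′ | _ = ⊑ⁿ-antisym (h-monotone v∈A′ v∈A ⊑ⁿ-refl) (h-monotone v∈A v∈A′ ⊑ⁿ-refl)
        ... | no v∉A   | _ = contradiction v∈A v∉A

      private
        strictly-below : ∀ {u v} → u ⊏ⁿ v → ¬ A v → completion u ⊑ⁿ completion v
        strictly-below {u} {v} (u⊑v , u≢v) v∉A with v ≟ⁿ ⊥ⁿ b
        ... | yes refl = contradiction (⊑ⁿ-antisym u⊑v (⊥ⁿ-least u)) u≢v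
        ... | no v≢⊥   = ⊑ⁿ-trans
          (⋁-upper (List.∈-map⁺ completion (List.∈-filter⁺ (_⊏ⁿ? v) (∈-allVecs u) (u⊑v , u≢v))))
          (⊑ⁿ-reflexive (sym (completion-∉ v∉A v≢⊥)))

        monotone : ∀ u → Acc _⊏ⁿ_ u → ∀ {v} → u ⊑ⁿ v → completion u ⊑ⁿ completion v
        monotone u (acc rs) {v} u⊑v with A? v | u ≟ⁿ v
        ... | _       | yes refl = ⊑ⁿ-refl
        ... | no v∉A  | no u≢v   = strictly-below (u⊑v , u≢v) v∉A
        ... | yes v∈A | no _ with A? u | u ≟ⁿ ⊥ⁿ b
        ...   | yes u∈A | _ = ⊑ⁿ-trans (⊑ⁿ-reflexive (completion-∈ u∈A))
          (⊑ⁿ-trans (h-monotone u∈A v∈A u⊑v) (⊑ⁿ-reflexive (sym (completion-∈ v∈A))))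
        ...   | no u∉A | yes refl = ⊑ⁿ-trans (⊑ⁿ-reflexive (completion-⊥ u∉A)) (⊥ⁿ-least _)
        ...   | no u∉A | no u≢⊥ = ⊑ⁿ-trans (⊑ⁿ-reflexive (completion-∉ u∉A u≢⊥))
          (⋁-least _ λ x∈ → below (List.∈-map⁻ completion x∈))
          where
          below : ∀ {x} → (∃ λ w → w List.∈ strictlyBelow u × x ≡ completion w) → x ⊑ⁿ completion v
          below (w , w∈ , refl) = monotone w (rs w⊏u) (⊑ⁿ-trans (proj₁ w⊏u) u⊑v)
            where w⊏u = strictlyBelow-⊏ w∈

      completion-monotone : Monotone completion
      completion-monotone {u} = monotone u (⊏ⁿ-wellFounded u)

module Encoding (𝔖 : Signature) {_≤_ : Rel (Signature.V 𝔖) 0ℓ} (tot : IsTotalOrder _≡_ _≤_)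
                {ℐ : Interpretation 𝔖} {m n : ℕ} (M : Mealy ℐ m n) where
  open Signature 𝔖
  open Interpretation ℐ
  open Functions ℐ
  open Completion ℐ
  open Mealy M
  open AccessibleStates 𝔖 tot M
  open Listing listing public

  γ : State → Vec V size
  γ s = Vec.tabulate λ i → if does (q i ≤? s) then ⊤ else •

  γ-monotone : ∀ {s t} → s ≼ t → γ s ⊑ⁿ γ t
  γ-monotone {s} {t} s≼t = Pointwise.tabulate⁺ bit where
    bit : ∀ i → (if does (q i ≤? s) then ⊤ else •) ⊑ (if does (q i ≤? t) then ⊤ else •)
    bit i with q i ≤? s | q i ≤? t
    ... | yes _   | yes _   = ⊑-refl
    ... | yes q≼s | no q⋠t  = contradiction (≼-trans q≼s s≼t) q⋠t
    ... | no _    | _       = minimum _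

  γ-reflects : ⊤ ≢ • → ∀ {i s} → γ (q i) ⊑ⁿ γ s → q i ≼ s
  γ-reflects ⊤≢• {i} {s} le with q i ≤? q i | q i ≤? s | Pointwise.tabulate⁻ le i
  ... | no q⋠q | _      | _   = contradiction ≼-refl q⋠q
  ... | yes _  | yes q≼s | _   = q≼s
  ... | yes _  | no _    | ⊤⊑• = contradiction (⊑-antisym ⊤⊑• (minimum _)) ⊤≢•

  -- γ[S] × V^m, where S has been cut down to the accessible states q₀, …, q_{k-1}
  Encoded : Vec V (size + m) → Set
  Encoded v = ∃[ i ] γ (q i) ≡ take size v

  encoded? : Unary.Decidable Encoded
  encoded? v = Fin.any? λ i → γ (q i) ≟ⁿ take size v

  encodedStep : ∀ v → Encoded v → Vec V (size + n)
  encodedStep v (i , _) = γ (next (q i) x) ++ output (q i) x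
    where x = drop size v

  private
    trivial : ⊤ ≡ • → ∀ {n} {u v : Vec V n} → u ⊑ⁿ v
    trivial ⊤≡• {u = u} {v} = ⊑ⁿ-trans (below u) (⊥ⁿ-least v) where
      below : ∀ {n} (u : Vec V n) → u ⊑ⁿ ⊥ⁿ n
      below []      = []
      below (x ∷ u) = subst (x ⊑_) ⊤≡• (maximum x) ∷ below u

    take-⊥ : ∀ k {m} → take k (⊥ⁿ (k + m)) ≡ ⊥ⁿ k
    take-⊥ zero    = refl
    take-⊥ (suc k) = cong (• ∷_) (take-⊥ k)

  encodedStep-monotone : ∀ {u v} (u∈ : Encoded u) (v∈ : Encoded v) → u ⊑ⁿ v →
                         encodedStep u u∈ ⊑ⁿ encodedStep v v∈
  encodedStep-monotone (i , eqᵢ) (j , eqⱼ) u⊑v with ⊤ ≟ⱽ •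
  ... | yes ⊤≡• = trivial ⊤≡•
  ... | no ⊤≢•  = Pointwise.++⁺ (γ-monotone (proj₁ steps)) (proj₂ steps)
    where
    qᵢ≼qⱼ = γ-reflects ⊤≢• (subst₂ _⊑ⁿ_ (sym eqᵢ) (sym eqⱼ) (take⁺ size u⊑v))
    steps = step-monotone qᵢ≼qⱼ (drop⁺ size u⊑v)

  ⊥-not-encoded : ⊤ ≢ • → ¬ Encoded (⊥ⁿ (size + m))
  ⊥-not-encoded ⊤≢• (i , eq) = ⊤≢• (begin
    ⊤                              ≡⟨ cong (if_then ⊤ else •) (sym (dec-true (q i ≤? q i) ≼-refl)) ⟩
    (if does (q i ≤? q i) then ⊤ else •) ≡⟨ sym (Vec.lookup∘tabulate _ i) ⟩
    Vec.lookup (γ (q i)) i         ≡⟨ cong (λ v → Vec.lookup v i) (trans eq (take-⊥ size)) ⟩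
    Vec.lookup (⊥ⁿ size) i         ≡⟨ Vec.lookup-replicate i • ⟩
    •                              ∎)
    where open ≡-Reasoning

  encoding : FuncMor (size + m) (size + n)
  encoding = record
    { app      = completion encoded? encodedStep
    ; monotone = completion-monotone encoded? encodedStep encodedStep-monotone
    ; bot      = bot }
    where
    bot : completion encoded? encodedStep (⊥ⁿ (size + m)) ≡ ⊥ⁿ (size + n)
    bot with ⊤ ≟ⱽ •
    ... | yes ⊤≡• = ⊑ⁿ-antisym (trivial ⊤≡•) (⊥ⁿ-least _)
    ... | no ⊤≢•  = completion-⊥ encoded? encodedStep (⊥-not-encoded ⊤≢•)

module Synthesis {𝔖 : Signature} {ℐ : Interpretation 𝔖} (𝒞 : Completeness ℐ)
                 {_≤_ : Rel (Signature.V 𝔖) 0ℓ} (tot : IsTotalOrder _≡_ _≤_) where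
  open Completeness 𝒞 using (‖_‖)
  open Circuits 𝔖

  ∥_∥≤ : ∀ {m n} → Mealy ℐ m n → SCirc m n
  ∥_∥≤ {m} M = Tr size ((reg (γ (Mealy.start M)) ⊗ idᵗ m) ⨾ ‖ encoding ‖)
    where open Encoding 𝔖 tot M using (size; γ; encoding)

{-# OPTIONS --safe #-}
-- Write s_i for the state that the machine reaches on the first i inputs of σ.
-- Delaying the fed back stream makes its value at each time depend on the
-- previous one only, so the fixed point equation has the single solution
-- i ↦ γ(s_{i+1}); leastness is not needed. With this feedback the encoding
-- is only evaluated at γ(s_i) with s_i accessible, where the monotone completion
-- agrees with the machine. For the machine of derivatives of f, s_i is the
-- derivative of f along the first i inputs, so its output is that of f.
module Submission where

open import Level using (0ℓ)
open import Data.Nat.Base using (ℕ; zero; suc; _+_)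
import Data.Nat.Properties as ℕ
open import Data.Product.Base using (∃-syntax; _,_; proj₁; proj₂)
open import Data.List.Base as List using ([]; _∷_)
import Data.List.Properties as List
import Data.List.Relation.Unary.Any as Any
import Data.List.Relation.Unary.Any.Properties as Any
open import Data.Vec.Base as Vec using (Vec; []; _∷_; _++_; take; drop)
import Data.Vec.Properties as Vec
open import Function.Base using (_∘_)
open import Relation.Binary.Core using (Rel)
open import Relation.Binary.Structures using (IsTotalOrder)
open import Relation.Binary.PropositionalEquality
  using (_≡_; refl; sym; trans; cong; cong₂; subst; module ≡-Reasoning)
open import Relation.Nullary.Decidable using (yes; no)
open import Defs

module Registers {𝔖 : Signature} (ℐ : Interpretation 𝔖) where
  open Signature 𝔖
  open Interpretation ℐ
  open StreamFunctions ℐ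
  open Circuits 𝔖
  open Denotation ℐ
  open Soundness ℐ

  ⊔ⁿ-identityʳ : ∀ {n} (v : Vec V n) → v ⊔ⁿ ⊥ⁿ n ≡ v
  ⊔ⁿ-identityʳ v = ⊑ⁿ-antisym (⊔ⁿ-least ⊑ⁿ-refl (⊥ⁿ-least v)) (⊔ⁿ-upperˡ v _)

  ⊔ⁿ-identityˡ : ∀ {n} (v : Vec V n) → ⊥ⁿ n ⊔ⁿ v ≡ v
  ⊔ⁿ-identityˡ v = ⊑ⁿ-antisym (⊔ⁿ-least (⊥ⁿ-least v) ⊑ⁿ-refl) (⊔ⁿ-upperʳ _ v)

  -- For `•` the circuit is the introduction generator, and its constant stream is already of the
  -- form `•` followed by `⊥`.
  ⟦value⟧ : ∀ v σ i → fn ⟦ value v ⟧ σ i ≡ ((v ∷ []) ◂ ⊥ˢ 1) i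
  ⟦value⟧ v σ i with v ≟ⱽ •
  ⟦value⟧ v σ zero    | yes v≡• = cong (_∷ []) (sym v≡•)
  ⟦value⟧ v σ (suc i) | yes _   = refl
  ⟦value⟧ v σ i       | no _    = refl

  ⟦valueⁿ⟧ : ∀ {n} (v : Vec V n) σ i → fn ⟦ valueⁿ v ⟧ σ i ≡ (v ◂ ⊥ˢ n) i
  ⟦valueⁿ⟧ []      σ zero    = sym ([]-unique _)
  ⟦valueⁿ⟧ []      σ (suc i) = sym ([]-unique _)
  ⟦valueⁿ⟧ (x ∷ v) σ zero    = cong₂ _++_ (⟦value⟧ x _ zero) (⟦valueⁿ⟧ v _ zero)
  ⟦valueⁿ⟧ (x ∷ v) σ (suc i) = cong₂ _++_ (⟦value⟧ x _ (suc i)) (⟦valueⁿ⟧ v _ (suc i))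

  ⟦delayⁿ⟧ : ∀ n σ i → fn ⟦ delayⁿ n ⟧ σ i ≡ (⊥ⁿ n ◂ σ) i
  ⟦delayⁿ⟧ zero    σ zero    = sym ([]-unique _)
  ⟦delayⁿ⟧ zero    σ (suc i) = trans (sym ([]-unique _)) ([]-unique _)
  ⟦delayⁿ⟧ (suc n) σ zero    = cong (• ∷_) (⟦delayⁿ⟧ n _ zero)
  ⟦delayⁿ⟧ (suc n) σ (suc i) = trans (cong (take 1 (σ i) ++_) (⟦delayⁿ⟧ n _ (suc i)))
    (Vec.take++drop≡id 1 (σ i))

  -- This first factor of `joinⁿ (suc n)` brings the two heads together. It acts elementwise, so
  -- knowing `σ` at the one time `i` is enough; the cast only reassociates.
  ⟦swap-inner⟧ : ∀ {n} x (u : Vec V n) y (v : Vec V n) σ i → σ i ≡ (x ∷ u) ++ (y ∷ v) →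
    fn ⟦ cast (cong suc (ℕ.+-assoc n 1 n)) refl (idᵗ 1 ⊗ (swap n 1 ⊗ idᵗ n)) ⟧ σ i ≡ x ∷ y ∷ u ++ v
  ⟦swap-inner⟧ {n} x u y v σ i eq = begin
    fn ⟦ cast e refl c ⟧ σ i
      ≡⟨ ⟦cast⟧ e refl c σ i ⟩
    Vec.cast refl (perm (Vec.cast (sym e) (σ i)))
      ≡⟨ Vec.cast-is-id refl _ ⟩
    perm (Vec.cast (sym e) (σ i))
      ≡⟨ cong perm (trans (cong (Vec.cast (sym e)) eq)
           (cong (x ∷_) (Vec.cast-sym (ℕ.+-assoc n 1 n) (Vec.++-assoc-eqFree u (y ∷ []) v)))) ⟩
    perm (x ∷ ((u ++ y ∷ []) ++ v))
      ≡⟨ cong (x ∷_) (cong₂ _++_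
           (cong (λ w → drop n w ++ take n w) (take-++ (u ++ y ∷ []) v))
           (drop-++ (u ++ y ∷ []) v)) ⟩
    x ∷ ((drop n (u ++ y ∷ []) ++ take n (u ++ y ∷ [])) ++ v)
      ≡⟨ cong (λ w → x ∷ w ++ v) (cong₂ _++_ (drop-++ u _) (take-++ u _)) ⟩
    x ∷ y ∷ u ++ v ∎
    where
    open ≡-Reasoning
    e = cong suc (ℕ.+-assoc n 1 n)
    c : SCirc (1 + ((n + 1) + n)) (1 + ((1 + n) + n))
    c = idᵗ 1 ⊗ (swap n 1 ⊗ idᵗ n)
    -- Since `c` consists of identities and swaps, its value at time 0 on a constant stream is the
    -- function it applies at every time.
    perm : Vec V (1 + ((n + 1) + n)) → Vec V (1 + ((1 + n) + n))
    perm w = fn ⟦ c ⟧ (λ _ → w) 0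

  -- After the swap, the first two wires carry the heads and the rest carry `u ++ v`, which is the
  -- hypothesis for the induction.
  ⟦joinⁿ⟧ : ∀ {n} (u v : Vec V n) σ i → σ i ≡ u ++ v → fn ⟦ joinⁿ n ⟧ σ i ≡ u ⊔ⁿ v
  ⟦joinⁿ⟧ []      []      σ i eq = eq
  ⟦joinⁿ⟧ (x ∷ u) (y ∷ v) σ i eq = cong₂ _++_
    (cong (λ w → fn ⟦ join ⟧ᶜ (λ _ → take 2 w) 0) inner)
    (⟦joinⁿ⟧ u v _ i (cong (drop 2) inner))
    where inner = ⟦swap-inner⟧ x u y v σ i eq

  -- The streams joined are `v, ⊥, ⊥, …` and `⊥, σ 0, σ 1, …`: at each time one of them is `⊥`, the
  -- unit of the join.
  ⟦reg⟧ : ∀ {n} (v : Vec V n) σ i → fn ⟦ reg v ⟧ σ i ≡ (v ◂ σ) i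
  ⟦reg⟧ {n} v σ i = trans
    (⟦joinⁿ⟧ _ _ _ i (cong₂ _++_ (⟦valueⁿ⟧ v _ i) (⟦delayⁿ⟧ n σ i))) (unit i)
    where
    unit : ∀ i → (v ◂ ⊥ˢ n) i ⊔ⁿ (⊥ⁿ n ◂ σ) i ≡ (v ◂ σ) i
    unit zero    = ⊔ⁿ-identityʳ v
    unit (suc i) = ⊔ⁿ-identityˡ (σ i)

module Trajectory {𝔖 : Signature} {ℐ : Interpretation 𝔖} {m n : ℕ} (M : Mealy ℐ m n) where
  open Signature 𝔖
  open Interpretation ℐ
  open Mealy M

  output-cong : ∀ {s t} a → s ≈ᴹ t → output s a ≡ output t a
  output-cong a s≈t = ⊑ⁿ-antisym (proj₂ (step-monotone (≼-reflexive s≈t) ⊑ⁿ-refl))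
                                 (proj₂ (step-monotone (≼-reflexive (Eq.sym s≈t)) ⊑ⁿ-refl))

  stateAt : Stream (Vec V m) → ℕ → State
  stateAt σ zero    = start
  stateAt σ (suc i) = next (stateAt σ i) (σ i)

  -- The listing of states covers those of the form `run w`, so each state on a trajectory needs a
  -- word leading to it.
  stateAt-accessible : ∀ σ i → ∃[ w ] run w ≡ stateAt σ i
  stateAt-accessible σ zero    = [] , refl
  stateAt-accessible σ (suc i) with stateAt-accessible σ i
  ... | w , eq = w List.∷ʳ σ i , trans (List.foldl-∷ʳ next start (σ i) w) (cong (λ s → next s (σ i)) eq)

module Realisation {𝔖 : Signature} {ℐ : Interpretation 𝔖} (𝒞 : Completeness ℐ)
                   {_≤_ : Rel (Signature.V 𝔖) 0ℓ} (tot : IsTotalOrder _≡_ _≤_)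
                   {m n : ℕ} (M : Mealy ℐ m n) where
  open Signature 𝔖
  open Interpretation ℐ
  open Functions ℐ
  open StreamFunctions ℐ
  open Circuits 𝔖
  open Denotation ℐ
  open Soundness ℐ using (take-++; drop-++)
  open Completeness 𝒞
  open Completion ℐ
  open Registers ℐ
  open Mealy M
  open Trajectory M
  open Encoding 𝔖 tot M
  open Synthesis 𝒞 tot
  open ≡-Reasoning

  γ-cong : ∀ {s t} → s ≈ᴹ t → γ s ≡ γ t
  γ-cong s≈t = ⊑ⁿ-antisym (γ-monotone (≼-reflexive s≈t)) (γ-monotone (≼-reflexive (Eq.sym s≈t)))

  -- The argument is encoded, with witness `i`, and there the completion extends `encodedStep`.
  encoding-listed : ∀ i a → app encoding (γ (q i) ++ a) ≡ γ (next (q i) a) ++ output (q i) a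
  encoding-listed i a = trans
    (completion-∈ encoded? encodedStep encodedStep-monotone (i , sym (take-++ (γ (q i)) a)))
    (cong (λ b → γ (next (q i) b) ++ output (q i) b) (drop-++ (γ (q i)) a))

  -- A listed state represents `run w` only up to `≈ᴹ`, but `γ`, `next` and `output` all respect
  -- `≈ᴹ`.
  encoding-accessible : ∀ w a → app encoding (γ (run w) ++ a) ≡ γ (next (run w) a) ++ output (run w) a
  encoding-accessible w a = begin
    app encoding (γ (run w) ++ a)           ≡⟨ cong (λ u → app encoding (u ++ a)) (γ-cong w≈q) ⟩
    app encoding (γ (q i) ++ a)             ≡⟨ encoding-listed i a ⟩
    γ (next (q i) a) ++ output (q i) a      ≡⟨ cong₂ _++_ (γ-cong (next-cong a (Eq.sym w≈q))) (output-cong a (Eq.sym w≈q)) ⟩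
    γ (next (run w) a) ++ output (run w) a  ∎
    where
    i   = Any.index (complete w)
    w≈q = Any.lookup-index (complete w)

  private
    body : SCirc (size + m) (size + n)
    body = (reg (γ start) ⊗ idᵗ m) ⨾ ‖ encoding ‖

  ⟦body⟧ : ∀ τ σ i → fn ⟦ body ⟧ (τ ++ˢ σ) i ≡ app encoding ((γ start ◂ τ) i ++ σ i)
  ⟦body⟧ τ σ i = trans (‖‖-correct encoding _ i) (cong (app encoding) (cong₂ _++_
    (trans (⟦reg⟧ (γ start) _ i) (register i)) (drop-++ (τ i) (σ i))))
    where
    register : ∀ i → (γ start ◂ (take size ∘ (τ ++ˢ σ))) i ≡ (γ start ◂ τ) i
    register zero    = refl
    register (suc i) = take-++ (τ i) (σ i)

  module _ (σ : Streamⁿ m) where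
    private
      s = stateAt σ
      μ = feedback {size} ⟦ body ⟧ σ

    -- The register content is a hypothesis because this is used twice: within the induction that
    -- establishes that content, and then to read off the output.
    ⟦body⟧-at-state : ∀ i → (γ start ◂ μ) i ≡ γ (s i) →
                      fn ⟦ body ⟧ (μ ++ˢ σ) i ≡ γ (s (suc i)) ++ output (s i) (σ i)
    ⟦body⟧-at-state i eq with stateAt-accessible σ i
    ... | w , run-w≡s = begin
      fn ⟦ body ⟧ (μ ++ˢ σ) i                    ≡⟨ ⟦body⟧ μ σ i ⟩
      app encoding ((γ start ◂ μ) i ++ σ i)      ≡⟨ cong (λ u → app encoding (u ++ σ i)) eq ⟩
      app encoding (γ (s i) ++ σ i)
        ≡⟨ subst (λ t → app encoding (γ t ++ σ i) ≡ γ (next t (σ i)) ++ output t (σ i))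
                 run-w≡s (encoding-accessible w (σ i)) ⟩
      γ (s (suc i)) ++ output (s i) (σ i)        ∎

    register-holds-state : ∀ i → (γ start ◂ μ) i ≡ γ (s i)
    register-holds-state zero    = refl
    register-holds-state (suc i) = begin
      -- At time `suc i` the register shows `μ i`, which the fixed point equation computes from the
      -- register at time `i`.
      μ i                                             ≡⟨ sym (Fixpoint.μ-fixed (loop {size} ⟦ body ⟧ σ) i) ⟩
      take size (fn ⟦ body ⟧ (μ ++ˢ σ) i)             ≡⟨ cong (take size) (⟦body⟧-at-state i (register-holds-state i)) ⟩
      take size (γ (s (suc i)) ++ output (s i) (σ i)) ≡⟨ take-++ (γ (s (suc i))) _ ⟩
      γ (s (suc i))                                   ∎

    ⟦∥∥⟧ : ∀ i → fn ⟦ ∥ M ∥≤ ⟧ σ i ≡ output (s i) (σ i)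
    ⟦∥∥⟧ i = trans (cong (drop size) (⟦body⟧-at-state i (register-holds-state i)))
                   (drop-++ (γ (s (suc i))) _)

module Behaviour {𝔖 : Signature} (ℐ : Interpretation 𝔖) where
  open StreamFunctions ℐ
  open Derivatives ℐ
  open ToMealy ℐ

  module _ {m n} (f : StreamMor m n) (σ : Streamⁿ m) where
    open Mealy ⟪ f ⟫ using (output)
    open Trajectory ⟪ f ⟫ using (stateAt)
    open ≡-Reasoning

    -- Deriving by `σ i` amounts to putting `σ i` back in front of the shifted input and reading one
    -- place later; hence `j` varies in the induction.
    stateAt-fn : ∀ i j → fn (proj₁ (stateAt σ i)) (λ k → σ (i + k)) j ≡ fn (streamFn f) σ (i + j)
    stateAt-fn zero    j = refl
    stateAt-fn (suc i) j = begin
      fn h (σ i ◂ λ k → σ (suc (i + k))) (suc j) ≡⟨ fn-cong h reindex (suc j) ⟩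
      fn h (λ k → σ (i + k)) (suc j)             ≡⟨ stateAt-fn i (suc j) ⟩
      fn (streamFn f) σ (i + suc j)              ≡⟨ cong (fn (streamFn f) σ) (ℕ.+-suc i j) ⟩
      fn (streamFn f) σ (suc (i + j))            ∎
      where
      h = proj₁ (stateAt σ i)
      reindex : ∀ k → (σ i ◂ λ k → σ (suc (i + k))) k ≡ σ (i + k)
      reindex zero    = cong σ (sym (ℕ.+-identityʳ i))
      reindex (suc k) = cong σ (sym (ℕ.+-suc i k))

    output-stateAt : ∀ i → output (stateAt σ i) (σ i) ≡ fn (streamFn f) σ i
    output-stateAt i = begin
      -- The head of the shifted input is `σ (i + 0)`. By causality, the `⊥` tail in `initial` may
      -- then be replaced by the actual later inputs.
      initial h (σ i)               ≡⟨ cong (initial h ∘ σ) (sym (ℕ.+-identityʳ i)) ⟩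
      initial h (σ (i + 0))         ≡⟨ sym (initial-independent h _ (λ k → σ (i + suc k))) ⟩
      fn h (σ (i + 0) ◂ λ k → σ (i + suc k)) 0
        ≡⟨ fn-cong h (λ { zero → refl ; (suc k) → refl }) 0 ⟩
      fn h (λ k → σ (i + k)) 0      ≡⟨ stateAt-fn i 0 ⟩
      fn (streamFn f) σ (i + 0)     ≡⟨ cong (fn (streamFn f) σ) (ℕ.+-identityʳ i) ⟩
      fn (streamFn f) σ i           ∎
      where h = proj₁ (stateAt σ i)

corollary4p98 : (𝔖 : Signature) (ℐ : Interpretation 𝔖) (𝒞 : Completeness ℐ)
    (_≤_ : Rel (Signature.V 𝔖) 0ℓ) (≤-isTotalOrder : IsTotalOrder _≡_ _≤_) →
    let open StreamFunctions ℐ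
        open Denotation ℐ
        open Derivatives ℐ
        open ToMealy ℐ
        open Synthesis 𝒞 ≤-isTotalOrder
    in {m n : ℕ} (f : StreamMor m n) →
       fn ⟦ ∥ ⟪ f ⟫ ∥≤ ⟧ ≈ˢ fn (streamFn f)
corollary4p98 𝔖 ℐ 𝒞 _≤_ ≤-isTotalOrder f σ i =
  trans (Realisation.⟦∥∥⟧ 𝒞 ≤-isTotalOrder ⟪ f ⟫ σ i) (Behaviour.output-stateAt ℐ f σ i)
  where open ToMealy ℐ
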